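{- There exists $n_0$ such that the following holds. Let $G$ be a triangle-free graph on $n\geq n_0$ vertices, where $n$ is divisible by $12$. Then there exists a partition $V(G)=A\cup B$ with $|A|=|B|=n/2$ such that $e(A)\leq n^2/18$ and $e(B)\leq n^2/18$.
   Context: For $S\subseteq V(G)$, $e(S)$ denotes the number of edges of $G$ with both endpoints in $S$. -}

module Defs where

open import Data.Nat using (ℕ; _+_; _<_)
open import Data.Bool using (Bool; true; false; _∧_; if_then_else_)
open import Data.Fin using (Fin; toℕ)
open import Data.Fin.Subset using (Subset; inside)
open import Data.List using (List; map; allFin; concatMap)
open import Data.Nat.ListAction using (sum)
open import Data.Vec using (lookup)
open import Data.Fin using (_<?_)
open import Relation.Nullary.Decidable using (⌊_⌋)
open import Relation.Binary.PropositionalEquality using (_≡_)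
open import Data.Empty using (⊥)
open import Relation.Nullary using (¬_)

record Graph (n : ℕ) : Set where
  field
    adj   : Fin n → Fin n → Bool
    sym   : ∀ i j → adj i j ≡ adj j i
    irrefl : ∀ i → adj i i ≡ false

open Graph public

TriangleFree : ∀ {n} → Graph n → Set
TriangleFree {n} G = ∀ (i j k : Fin n) →
  ¬ (adj G i j ≡ true × adj G j k ≡ true × adj G i k ≡ true)
  where open import Data.Product using (_×_)

e : ∀ {n} → Graph n → Subset n → ℕ
e {n} G S = sum (concatMap (λ i → map (λ j → count i j) (allFin n)) (allFin n))
  where
  count : Fin n → Fin n → ℕ
  count i j = if ⌊ i <? j ⌋ ∧ lookup S i ∧ lookup S j ∧ adj G i j then 1 else 0

{-# OPTIONS --safe #-}
-- Write n = 6K. If e(G) ≤ 2n²/9 - n, sort the vertices by degree and send the two vertices of each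
-- consecutive pair to different sides: a greedy choice keeps at most half of the edges inside the parts,
-- while the degree sums of the parts, hence also their edge counts, differ by at most the maximum degree.
--
-- Otherwise let X be the neighbourhood of a vertex of maximum degree x, an independent set, and Z the
-- remaining vertices. All degrees are at most x, so a vertex of Z with q neighbours in Z misses at least q vertices of X.
-- By triangle-freeness the vertices of Z seeing more than half of X form an independent set W; put C = Z ∖ W.
--   x ≤ n/2: one part is X filled up by any vertices of Z.
--   x ≥ 2n/3: one part has n/3 vertices of X and n/6 of W; the other one is no denser than in
--     the complete bipartite graph, since the edges inside Z are paid for by missing edges to X.
--   x = 2n/3 - s with s > 0: take one part inside X, consisting of vertices of largest degree. If this fails,
--     then e(X,Z) + 2e(Z) ≥ xz + s² - 2n/3 - 2s. Hence s = O(√n), and |C| ≤ 2, because a vertex of C has its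
--     neighbourhood almost within X or almost within Z, so its degree is at most about n/3. If |C| ≤ s, take
--     n/6 vertices of X and n/3 of W; the remaining case s = 1, |C| = 2 goes like x ≥ 2n/3.
module Submission where

open import Defs renaming (sym to adj-sym)
open import Algebra.Bundles using (CommutativeMonoid)
import Algebra.Properties.CommutativeSemigroup as CommutativeSemigroup
open import Data.Bool using (Bool; true; false; if_then_else_; not; _∧_)
import Data.Bool.Properties as Bool
open import Data.Empty using (⊥)
open import Data.Fin using (Fin; zero; suc; _<?_)
open import Data.Fin.Properties using (<-cmp; _≟_)
open import Data.Fin.Subset using (Subset; ∣_∣; ∁)
open import Data.Fin.Subset.Properties using (∣∁p∣≡n∸∣p∣)
open import Data.Nat hiding (_≟_; _<?_; <-cmp)
open import Data.Nat.Divisibility using () renaming (_∣_ to _divides_)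
import Data.Nat.Divisibility as Divisibility
open import Data.Nat.ListAction using (sum)
open import Data.Nat.ListAction.Properties using (sum-++; sum-↭)
open import Data.Nat.Properties hiding (_≟_; _<?_; <-cmp)
open import Data.Nat.Tactic.RingSolver using (solve-∀)
open import Data.List using (List; []; _∷_; _++_; map; length; concatMap; take; drop; allFin; tabulate)
open import Data.List.Extrema ≤-totalOrder using (argmax; f[xs]≤f[argmax])
import Data.List.Membership.DecPropositional as DecMembership
open import Data.List.Membership.Propositional using (_∈_; _∉_)
open import Data.List.Membership.Propositional.Properties using (∈-allFin)
open import Data.List.Properties
  using (map-++; map-tabulate; ++-assoc; take++drop≡id; length-++; length-take; length-drop; length-tabulate)
open import Data.List.Relation.Binary.Permutation.Propositional
  using (_↭_; prep; ↭-refl; ↭-sym; ↭-trans; ↭-reflexive; ↭⇒↭ₛ)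
open import Data.List.Relation.Binary.Permutation.Propositional.Properties
  using (map⁺; ↭-length; shift; shifts; ++-comm; ++⁺; ++⁺ˡ; ++⁺ʳ; ++-commutativeMonoid)
import Data.List.Relation.Binary.Permutation.Setoid.Properties as PermutationSetoid
open import Data.List.Relation.Unary.All as All using (All; []; _∷_)
import Data.List.Relation.Unary.All.Properties as All
open import Data.List.Relation.Unary.AllPairs using (AllPairs; []; _∷_)
open import Data.List.Relation.Unary.Linked.Properties using (Linked⇒AllPairs)
open import Data.List.Relation.Unary.Unique.Propositional using (Unique)
import Data.List.Relation.Unary.Unique.Propositional.Properties as Unique
import Data.List.Sort as Sort
open import Data.Product using (∃; ∃₂; _×_; _,_; proj₁; proj₂)
open import Data.Sum using (_⊎_; inj₁; inj₂; [_,_]′)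
import Data.Vec as Vec
open import Data.Vec.Properties using (lookup∘tabulate; lookup-map)
open import Function using (_∘_; id)
open import Relation.Binary using (tri<; tri≈; tri>)
import Relation.Binary.Construct.On as On
open import Relation.Binary.PropositionalEquality
  using (_≡_; refl; sym; trans; cong; cong₂; subst; setoid; module ≡-Reasoning)
open import Relation.Nullary using (Dec; yes; no; does; ¬_; contradiction)
open import Relation.Nullary.Decidable using (⌊_⌋; isYes≗does; dec-true; dec-false)
open import Relation.Unary using (Decidable)

-- Sums over lists

private variable
  A B : Set

∑ : List A → (A → ℕ) → ℕ
∑ L f = sum (map f L)

∑-++ : ∀ (K L : List A) f → ∑ (K ++ L) f ≡ ∑ K f + ∑ L f
∑-++ K L f rewrite map-++ f K L = sum-++ (map f K) (map f L)

∑-↭ : ∀ {K L : List A} f → K ↭ L → ∑ K f ≡ ∑ L f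
∑-↭ f p = sum-↭ (map⁺ f p)

∑-mono : ∀ {L : List A} {f g} → All (λ i → f i ≤ g i) L → ∑ L f ≤ ∑ L g
∑-mono []       = ≤-refl
∑-mono (p ∷ ps) = +-mono-≤ p (∑-mono ps)

∑-cong : ∀ {L : List A} {f g} → All (λ i → f i ≡ g i) L → ∑ L f ≡ ∑ L g
∑-cong []       = refl
∑-cong (p ∷ ps) = cong₂ _+_ p (∑-cong ps)

always : ∀ {P : A → Set} → (∀ i → P i) → ∀ L → All P L
always p L = All.tabulate (λ {i} _ → p i)

∑-+ : ∀ (L : List A) f g → ∑ L (λ i → f i + g i) ≡ ∑ L f + ∑ L g
∑-+ []      f g = refl
∑-+ (i ∷ L) f g rewrite ∑-+ L f g = interchange (f i) (g i) (∑ L f) (∑ L g)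
  where
  interchange : ∀ a b c d → a + b + (c + d) ≡ a + c + (b + d)
  interchange = solve-∀

∑-const : ∀ (L : List A) c → ∑ L (λ _ → c) ≡ length L * c
∑-const []      c = refl
∑-const (i ∷ L) c = cong (c +_) (∑-const L c)

∑-zero : ∀ {L : List A} {f} → All (λ i → f i ≡ 0) L → ∑ L f ≡ 0
∑-zero {L = L} p = trans (∑-cong p) (trans (∑-const L 0) (*-zeroʳ (length L)))

∑-*ˡ : ∀ c (L : List A) f → ∑ L (λ i → c * f i) ≡ c * ∑ L f
∑-*ˡ c []      f = sym (*-zeroʳ c)
∑-*ˡ c (i ∷ L) f rewrite ∑-*ˡ c L f = sym (*-distribˡ-+ c (f i) (∑ L f))

∑-bound : ∀ {L : List A} {f c} → All (λ i → f i ≤ c) L → ∑ L f ≤ length L * c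
∑-bound {L = L} {c = c} p = ≤-trans (∑-mono p) (≤-reflexive (∑-const L c))

∑-swap : ∀ (K : List A) (L : List B) (f : A → B → ℕ) →
         ∑ K (λ i → ∑ L (f i)) ≡ ∑ L (λ j → ∑ K (λ i → f i j))
∑-swap []      L f = sym (trans (∑-const L 0) (*-zeroʳ (length L)))
∑-swap (i ∷ K) L f rewrite ∑-swap K L f = sym (∑-+ L (f i) (λ j → ∑ K (λ i → f i j)))

sum-concatMap : ∀ (K : List A) (L : List B) (f : A → B → ℕ) →
                sum (concatMap (λ i → map (f i) L) K) ≡ ∑ K (λ i → ∑ L (f i))
sum-concatMap []      L f = refl
sum-concatMap (i ∷ K) L f
  rewrite sum-++ (map (f i) L) (concatMap (λ i → map (f i) L) K) =
  cong (∑ L (f i) +_) (sum-concatMap K L f)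

-- Sorting, splitting and filtering lists

AllPairs-cross : ∀ {R : A → A → Set} K {L} → AllPairs R (K ++ L) → All (λ i → All (R i) L) K
AllPairs-cross []      _        = []
AllPairs-cross (i ∷ K) (p ∷ ps) = All.++⁻ʳ K p ∷ AllPairs-cross K ps

sort-by : (w : A → ℕ) (L : List A) →
          ∃ λ L′ → L′ ↭ L × AllPairs (λ i j → w i ≤ w j) L′
sort-by w L = S.sort L , S.sort-↭ L , Linked⇒AllPairs ≤-trans (S.sort-↗ L)
  where module S = Sort (On.decTotalOrder ≤-decTotalOrder w)

split : ∀ (L : List A) a b → length L ≡ a + b →
        ∃₂ λ T U → T ++ U ≡ L × length T ≡ a × length U ≡ b
split L a b eq = take a L , drop a L , take++drop≡id a L ,
  trans (length-take a L) (trans (cong (a ⊓_) eq) (m≤n⇒m⊓n≡m (m≤m+n a b))) ,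
  trans (length-drop a L) (trans (cong (_∸ a) eq) (m+n∸m≡n a b))

-- After sorting, every weight in `T` is at most every weight in `U`; summing over all pairs
-- compares the averages, stated cross-multiplied to stay in ℕ.
split-light : ∀ (w : A → ℕ) L a b → length L ≡ a + b →
  ∃₂ λ T U → T ++ U ↭ L × length T ≡ a × length U ≡ b × b * ∑ T w ≤ a * ∑ U w
split-light w L a b eq with sort-by w L
... | L′ , L′↭L , sorted with split L′ a b (trans (↭-length L′↭L) eq)
... | T , U , refl , refl , refl = T , U , L′↭L , refl , refl , (begin
  length U * ∑ T w            ≡⟨ ∑-*ˡ (length U) T w ⟨
  ∑ T (λ i → length U * w i)  ≤⟨ ∑-mono (All.map below (AllPairs-cross T sorted)) ⟩
  ∑ T (λ _ → ∑ U w)           ≡⟨ ∑-const T _ ⟩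
  length T * ∑ U w            ∎)
  where
  open ≤-Reasoning
  below : ∀ {i} → All (λ j → w i ≤ w j) U → length U * w i ≤ ∑ U w
  below {i} p = ≤-trans (≤-reflexive (sym (∑-const U (w i)))) (∑-mono p)

↭-filter : ∀ {P : A → Set} (P? : Decidable P) L →
           ∃₂ λ K M → K ++ M ↭ L × All P K × All (λ i → ¬ P i) M
↭-filter P? []      = [] , [] , ↭-refl , [] , []
↭-filter P? (i ∷ L) with P? i | ↭-filter P? L
... | yes p | K , M , eq , all-P , none-P = i ∷ K , M , prep i eq , p ∷ all-P , none-P
... | no ¬p | K , M , eq , all-P , none-P =
  K , i ∷ M , ↭-trans (shift i K M) (prep i eq) , all-P , ¬p ∷ none-P

++-↭-assoc : ∀ {A : Set} (K : List A) {L M N} → L ++ M ↭ N → (K ++ L) ++ M ↭ K ++ N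
++-↭-assoc K {L} {M} p = ↭-trans (↭-reflexive (++-assoc K L M)) (++⁺ˡ K p)

length-↭ : ∀ {A : Set} (K L : List A) {M} → K ++ L ↭ M → length M ≡ length K + length L
length-↭ K L p = trans (sym (↭-length p)) (length-++ K)

-- Indicators, cardinalities and decisions

𝟙 : Bool → ℕ
𝟙 b = if b then 1 else 0

card-tabulate : ∀ {m} (f : Fin m → Bool) → ∣ Vec.tabulate f ∣ ≡ sum (tabulate (𝟙 ∘ f))
card-tabulate {zero}  f = refl
card-tabulate {suc m} f with f zero
... | true  = cong suc (card-tabulate (f ∘ suc))
... | false = card-tabulate (f ∘ suc)

Unique⇒disjoint : ∀ {A : Set} (K : List A) {L} → Unique (K ++ L) → ∀ {i} → i ∈ K → i ∉ L
Unique⇒disjoint K u i∈K i∈L = All.lookup (All.lookup (AllPairs-cross K u) i∈K) i∈L refl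

⌊⌋-true : ∀ {P : Set} (P? : Dec P) → P → ⌊ P? ⌋ ≡ true
⌊⌋-true P? p = trans (isYes≗does P?) (dec-true P? p)

⌊⌋-false : ∀ {P : Set} (P? : Dec P) → ¬ P → ⌊ P? ⌋ ≡ false
⌊⌋-false P? ¬p = trans (isYes≗does P?) (dec-false P? ¬p)

-- Arithmetic

-- The hypothesis says q - p = (r - l) + rest, freed from subtraction so that the ring solver over ℕ can check it.
≤-cert : ∀ {l r p q} rest → l ≤ r → p + r + rest ≡ q + l → p ≤ q
≤-cert {l} {r} {p} {q} rest l≤r eq = +-cancelʳ-≤ l p q (begin
  p + l         ≤⟨ +-monoʳ-≤ p l≤r ⟩
  p + r         ≤⟨ m≤m+n (p + r) rest ⟩
  p + r + rest  ≡⟨ eq ⟩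
  q + l         ∎)
  where open ≤-Reasoning

<-cert : ∀ {l r} rest → l ≤ r → r + suc rest ≡ l → ⊥
<-cert {l} {r} rest l≤r refl = m+1+n≰m r l≤r

-- Notation of the arithmetic lemmas: n = 6K, x = |X|, z = |Z|, c = |C|, w = |W|, m = E X Z, F = E Z Z and
-- T = E V V = 2m + F, where E counts ordered pairs, so that a part with e ≤ n²/18 edges is one with E ≤ 4K².

-- A dense graph with all degrees at most `x` has `3x ≥ 8K - 6`, so `3y ≤ K + 6`; together with
-- `x ≤ 3K` this gives `2yx ≤ 2K(K + 6)`, and `6 ≤ K` finishes.
small-x₁ : ∀ {K x y T} .{{_ : NonZero K}} → x + y ≡ 3 * K → T ≤ 6 * K * x → 16 * (K * K) ≤ T + 12 * K →
           6 ≤ K → 2 * (y * x) ≤ 4 * (K * K)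
small-x₁ {K} {x} {y} {T} x+y few dense 6≤K = *-cancelˡ-≤ 3
  (≤-cert 0 (+-mono-≤ (*-monoʳ-≤ (2 * x) 3y≤K+6) (+-mono-≤ (*-monoˡ-≤ (2 * (K + 6)) x≤3K) (*-monoʳ-≤ (6 * K) 6≤K)))
    (eq₃ K x y))
  where
  eq₁ : ∀ K x T → 2 * K * (8 * K) + (T + 12 * K + 6 * K * x) + 0 ≡ 2 * K * (3 * x + 6) + (16 * (K * K) + T)
  eq₁ = solve-∀
  eq₂ : ∀ K x y → 3 * y + ((3 * x + 6) + 3 * (3 * K)) + 0 ≡ K + 6 + (8 * K + 3 * (x + y))
  eq₂ = solve-∀
  eq₃ : ∀ K x y → 3 * (2 * (y * x)) + (2 * x * (K + 6) + (3 * K * (2 * (K + 6)) + 6 * K * K)) + 0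
        ≡ 3 * (4 * (K * K)) + (2 * x * (3 * y) + (x * (2 * (K + 6)) + 6 * K * 6))
  eq₃ = solve-∀
  8K≤3x+6 : 8 * K ≤ 3 * x + 6
  8K≤3x+6 = *-cancelˡ-≤ (2 * K) {{m*n≢0 2 K}} (≤-cert 0 (+-mono-≤ dense few) (eq₁ K x T))
  3y≤K+6 : 3 * y ≤ K + 6
  3y≤K+6 = ≤-cert 0 (+-mono-≤ 8K≤3x+6 (≤-reflexive (cong (3 *_) x+y))) (eq₂ K x y)
  x≤3K : x ≤ 3 * K
  x≤3K = ≤-trans (m≤m+n x y) (≤-reflexive x+y)

-- Since `xz = 9K² - y²`, subtracting the density bound from `2xz` leaves at most `2K² + 12K`.
small-x₂ : ∀ {K x y z F T} → x + y ≡ 3 * K → z ≡ y + 3 * K → F + T ≤ 2 * (x * z) → 16 * (K * K) ≤ T + 12 * K →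
           6 ≤ K → F ≤ 4 * (K * K)
small-x₂ {K} {x} {y} {z} {F} {T} x+y refl spread dense 6≤K =
  ≤-cert (2 * (y * y)) (+-mono-≤ spread (+-mono-≤ dense (+-mono-≤ (*-monoʳ-≤ (2 * K) 6≤K) (+-mono-≤
      (≤-reflexive square) (≤-reflexive prod)))))
    (eq K x y F T)
  where
  square : 2 * ((x + y) * (x + y)) ≡ 2 * ((3 * K) * (3 * K))
  square = cong (λ t → 2 * (t * t)) x+y
  prod : 2 * (x * (y + 3 * K)) ≡ 2 * (x * (y + (x + y)))
  prod = cong (λ t → 2 * (x * (y + t))) (sym x+y)
  eq : ∀ K x y F T →
    F + (2 * (x * (y + 3 * K)) + (T + 12 * K + (2 * K * K + (2 * ((3 * K) * (3 * K)) + 2 * (x * (y +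
        (x + y))))))) + 2 * (y * y)
    ≡ 4 * (K * K) + (F + T + (16 * (K * K) + (2 * K * 6 + (2 * ((x + y) * (x + y)) + 2 * (x * (y + 3 * K))))))
  eq = solve-∀

-- Density and `m + F ≤ zx` force `m ≥ 16K² - 12K - zx`, and `zx ≤ 8K²`. So `cx ≤ 2(zx - m) ≤ 24K`,
-- while `x ≥ 4K`.
few-exceptional : ∀ {K x z s c m F} .{{_ : NonZero K}} → x ≡ 4 * K + s → z + s ≡ 2 * K →
  m + F ≤ z * x → 16 * (K * K) ≤ 2 * m + F + 12 * K → 2 * m + c * x ≤ 2 * (z * x) → c ≤ 6
few-exceptional {K} {x} {z} {s} {c} {m} {F} refl z+s spread dense miss =
  *-cancelˡ-≤ (4 * K) {{m*n≢0 4 K}} (≤-cert (8 * K * s + c * s + 4 * s * s) (+-mono-≤ miss (+-mono-≤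
      (*-monoʳ-≤ 2 spread) (+-mono-≤ (*-monoʳ-≤ 2 dense) (*-monoˡ-≤ (16 * K + 4 * s) (≤-reflexive z+s)))))
      (eq K c m s F z))
  where
    eq : ∀ K c m s F z →
      4 * K * c + (2 * (z * (4 * K + s)) + (2 * (z * (4 * K + s)) + (2 * (2 * m + F + 12 * K) + (2 * K *
          (16 * K + 4 * s))))) + (8 * K * s + c * s + 4 * s * s)
      ≡ 4 * K * 6 + (2 * m + c * (4 * K + s) + (2 * (m + F) + (2 * (16 * (K * K)) + ((z + s) * (16 * K + 4 * s)))))
    eq = solve-∀

-- From `16K² - 12K ≤ 2zx ≤ 12Kz` follows `3z ≥ 4K - 3`; the threshold 21 makes this at least
-- `3(K + 6)`.
large-Z : ∀ {K x z T} .{{_ : NonZero K}} → x ≤ 6 * K → T ≤ 2 * (z * x) →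
  16 * (K * K) ≤ T + 12 * K → 21 ≤ K → K + 6 ≤ z
large-Z {K} {x} {z} {T} x≤6K few dense 21≤K = *-cancelˡ-≤ 3 (≤-cert 0 (+-mono-≤ 4K≤3z+3 21≤K) (eq₂ K z))
  where
    eq₁ : ∀ K z T x →
      4 * K * (4 * K) + (T + 12 * K + (2 * (z * x) + (6 * K * (2 * z)))) + 0
      ≡ 4 * K * (3 * z + 3) + (16 * (K * K) + (T + (x * (2 * z))))
    eq₁ = solve-∀
    eq₂ : ∀ K z →
      3 * (K + 6) + (3 * z + 3 + K) + 0
      ≡ 3 * z + (4 * K + 21)
    eq₂ = solve-∀
    4K≤3z+3 : 4 * K ≤ 3 * z + 3
    4K≤3z+3 = *-cancelˡ-≤ (4 * K) {{m*n≢0 4 K}} (≤-cert 0 (+-mono-≤ dense (+-mono-≤ few (*-monoˡ-≤ (2 * z) x≤6K)))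
        (eq₁ K z T x))

-- The lightness hypothesis says `xp ≤ x′(p + q)`. As `2x′ ≥ x`, the term `r` can be absorbed:
-- `x(2p + r) ≤ 2x′(p + q + r) ≤ 2x′ux`, and `2x′u = 2(2K + s)(K - s) ≤ 4K²`.
wide-bound : ∀ {K x x′ s u p q r} .{{_ : NonZero K}} → K ≡ u + s → x′ ≡ 2 * K + s → x ≡ 2 * K + x′ →
  2 * K * p ≤ x′ * q → p + q + r ≤ u * x → 2 * p + r ≤ 4 * (K * K)
wide-bound {K} {x} {x′} {s} {u} {p} {q} {r} K≡u+s refl refl light spread =
  ≤-trans (*-cancelˡ-≤ (2 * K + (2 * K + s)) {{wide-nonZero K s}} (≤-cert (r * s) (+-mono-≤ (*-monoʳ-≤ 2 light)
      (*-monoʳ-≤ (2 * (2 * K + s)) spread)) (eq₁ K s p r u q))) (final K≡u+s)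
  where
    eq₁ : ∀ K s p r u q →
      (2 * K + (2 * K + s)) * (2 * p + r) + (2 * ((2 * K + s) * q) + (2 * (2 * K + s) * (u * (2 * K +
          (2 * K + s))))) + (r * s)
      ≡ (2 * K + (2 * K + s)) * (2 * ((2 * K + s) * u)) + (2 * (2 * K * p) + (2 * (2 * K + s) * (p + q + r)))
    eq₁ = solve-∀
    eq₂ : ∀ u s →
      2 * ((2 * (u + s) + s) * u) + 0 + (4 * s * s + 2 * s * u)
      ≡ 4 * ((u + s) * (u + s)) + 0
    eq₂ = solve-∀
    wide-nonZero : ∀ K s .{{_ : NonZero K}} → NonZero (2 * K + (2 * K + s))
    wide-nonZero (suc _) s = _
    final : K ≡ u + s → 2 * ((2 * K + s) * u) ≤ 4 * (K * K)
    final refl = ≤-cert (4 * s * s + 2 * s * u) z≤n (eq₂ u s)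

-- The analogue of `wide-bound` for `x = 4K - 1`. Now `2x′ = x - 1`, so absorbing `r` costs one
-- extra `r`, which the bound `(j + 2)²` controls; the slack comes from two vertices having total
-- degree at most `5K` instead of `2x`.
tight-bound : ∀ {K x x′ j p q r} → K ≡ 1 + j → x′ ≡ 2 * j + 1 → x ≡ 4 * j + 3 → 3 ≤ j →
  2 * K * p ≤ x′ * q → p + q + r ≤ j * x + 5 * K → r ≤ (j + 2) * (j + 2) → 2 * p + r ≤ 4 * (K * K)
tight-bound {j = j} {p = p} {q = q} {r = r} refl refl refl 3≤j light spread small =
  *-cancelˡ-≤ (4 * j + 3) {{m+1+n-nonZero (4 * j) 2}} (≤-cert (2 * j * j + 2 * j + 1) (+-mono-≤ (*-monoʳ-≤ 2 light)
      (+-mono-≤ (*-monoʳ-≤ (2 * (2 * j + 1)) spread) (+-mono-≤ small (+-mono-≤ (*-monoʳ-≤ j 3≤j) 3≤j)))) (eq j p r q))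
  where
    eq : ∀ j p r q →
      (4 * j + 3) * (2 * p + r) + (2 * ((2 * j + 1) * q) + (2 * (2 * j + 1) * (j * (4 * j + 3) + 5 * (1 + j)) +
          ((j + 2) * (j + 2) + (j * j + j)))) + (2 * j * j + 2 * j + 1)
      ≡ (4 * j + 3) * (4 * ((1 + j) * (1 + j))) + (2 * (2 * (1 + j) * p) + (2 * (2 * j + 1) * (p + q + r) + (r +
          (j * 3 + 3))))
    eq = solve-∀
    m+1+n-nonZero : ∀ m n → NonZero (m + suc n)
    m+1+n-nonZero m n rewrite +-suc m n = _

-- Adding `x` times the failure `4K² ≤ 2q + F`, twice the lightness inequality and `z` times the
-- density bound gives `p`, `q` and `F` the same coefficient `6K`, which is then cancelled.
deficit : ∀ {K x z y s p q F} .{{_ : NonZero K}} → K ≡ y + s → x ≡ 3 * K + y → z ≡ 2 * K + s →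
  3 * K * q ≤ y * p → 4 * (K * K) ≤ 2 * q + F → 16 * (K * K) ≤ 2 * (p + q) + F + 12 * K →
  s * s + z * x ≤ 4 * K + 2 * s + (p + q + F)
deficit {y = y} {s} {p} {q} {F} refl refl refl light bad dense =
  *-cancelˡ-≤ (6 * (y + s)) {{m*n≢0 6 (y + s)}} (≤-cert 0 (+-mono-≤ (*-monoʳ-≤ (3 * (y + s) + y) bad) (+-mono-≤
      (*-monoʳ-≤ 2 light) (*-monoʳ-≤ (2 * (y + s) + s) dense))) (eq y s p q F))
  where
    eq : ∀ y s p q F →
      6 * (y + s) * (s * s + (2 * (y + s) + s) * (3 * (y + s) + y)) + ((3 * (y + s) + y) * (2 * q + F) + (2 *
          (y * p) + ((2 * (y + s) + s) * (2 * (p + q) + F + 12 * (y + s))))) + 0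
      ≡ 6 * (y + s) * (4 * (y + s) + 2 * s + (p + q + F)) + ((3 * (y + s) + y) * (4 * ((y + s) * (y + s))) + (2 *
          (3 * (y + s) * q) + ((2 * (y + s) + s) * (16 * ((y + s) * (y + s))))))
    eq = solve-∀

-- Here `1056 = 16 · 66` is used: if `16s > K` then `s > 66`, and `66s ≤ s² ≤ 4K + 2s` yields
-- `16s ≤ K` after all.
s-small : ∀ {K s} → 1056 ≤ K → s * s ≤ 4 * K + 2 * s → 16 * s ≤ K
s-small {K} {s} 1056≤K s²≤ = ≮⇒≥ λ K<16s → <⇒≱ K<16s (*-cancelˡ-≤ 4 (bound (<⇒≤ (*-cancelˡ-< 16 66 s
    (≤-<-trans 1056≤K K<16s)))))
  where
    eq : ∀ s K →
      4 * (16 * s) + (s * s + (4 * K + 2 * s)) + 0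
      ≡ 4 * K + (s * 66 + (s * s))
    eq = solve-∀
    bound : 66 ≤ s → 4 * (16 * s) ≤ 4 * K
    bound 66≤s = ≤-cert 0 (+-mono-≤ (*-monoʳ-≤ s 66≤s) s²≤) (eq s K)

-- Here `p` and `q` are the degrees of a vertex into `X` and into `Z`. The hypotheses give
-- `qp ≤ 2zx - 16K² + 12K ≤ 4Ks + 12K`, so `qp/z ≤ 2s + 6`. As `p` and `q` are at most `z`, this
-- forces `p + q ≤ z + qp/z ≤ 2K + 3s + 6`.
light-exceptional : ∀ {K x z s p q m F} → x + s ≡ 4 * K → z ≡ 2 * K + s → 16 * s ≤ K → 24 ≤ K →
  2 * p ≤ x → q ≤ z → q * p + m ≤ z * x → m + F ≤ z * x → 16 * (K * K) ≤ 2 * m + F + 12 * K → 2 * (p + q) ≤ 5 * K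
light-exceptional {K} {x} {z} {s} {p} {q} {m} {F} x+s≡4K z≡ 16s≤K 24≤K 2p≤x q≤z sparse spread dense =
  ≮⇒≥ λ large → impossible z≡ (product-bound large)
  where
    eq₁ : ∀ z K x p q m F →
      z + 5 * (z * K) + 32 * (K * K) + (z * (2 * (p + q)) + (2 * (z * z + q * p) + (2 * (z * x) + (2 * (z * x) +
          (2 * (2 * m + F + 12 * K)))))) + 0
      ≡ 2 * (z * z) + 4 * (z * x) + 24 * K + (z * (1 + 5 * K) + (2 * (z * p + z * q) + (2 * (q * p + m) + (2 *
          (m + F) + (2 * (16 * (K * K)))))))
    eq₁ = solve-∀
    eq₂ : ∀ K s x →
      16 * (2 * ((2 * K + s) * (2 * K + s)) + 4 * ((2 * K + s) * x) + 24 * K) + (64 * (2 * K + s) * (4 * K) +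
          (11 * K * K + (16 * K * K + K))) + (1 + (5 * K * K + 32 * s * s + 31 * K + 16 * s + 23))
      ≡ 16 * ((2 * K + s) + 5 * ((2 * K + s) * K) + 32 * (K * K)) + (64 * (2 * K + s) * (x + s) + (11 * K *
          (16 * s) + (16 * K * 24 + 24)))
    eq₂ = solve-∀
    eq₃ : ∀ p K s x →
      2 * p + (x + (4 * K)) + (3 * s)
      ≡ 2 * (2 * K + s) + (2 * p + (x + s))
    eq₃ = solve-∀
    -- (z − p)(z − q) ≥ 0
    corner : ∀ {z p q} → p ≤ z → q ≤ z → z * p + z * q ≤ z * z + q * p
    corner {z} {p} {q} p≤z q≤z with m≤n⇒∃[o]m+o≡n p≤z
    ... | u , refl = ≤-cert 0 (*-monoʳ-≤ u q≤z) (eq₄ p u q)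
      where
      eq₄ : ∀ p u q → (p + u) * p + (p + u) * q + u * (p + u) + 0 ≡ (p + u) * (p + u) + q * p + u * q
      eq₄ = solve-∀
    p≤z : p ≤ z
    p≤z = subst (p ≤_) (sym z≡) (*-cancelˡ-≤ 2 (≤-cert (3 * s) (+-mono-≤ 2p≤x (≤-reflexive x+s≡4K)) (eq₃ p K s x)))
    product-bound : 5 * K < 2 * (p + q) → z + 5 * (z * K) + 32 * (K * K) ≤ 2 * (z * z) + 4 * (z * x) + 24 * K
    product-bound large = ≤-cert 0 (+-mono-≤ (*-monoʳ-≤ z large) (+-mono-≤ (*-monoʳ-≤ 2 (corner p≤z q≤z)) (+-mono-≤
        (*-monoʳ-≤ 2 sparse) (+-mono-≤ (*-monoʳ-≤ 2 spread) (*-monoʳ-≤ 2 dense))))) (eq₁ z K x p q m F)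
    final : (2 * K + s) + 5 * ((2 * K + s) * K) + 32 * (K * K) ≤ 2 * ((2 * K + s) * (2 * K + s)) + 4 *
        ((2 * K + s) * x) + 24 * K → ⊥
    final product-bound = <-cert (5 * K * K + 32 * s * s + 31 * K + 16 * s + 23) (+-mono-≤
        (*-monoʳ-≤ 16 product-bound) (+-mono-≤ (*-monoʳ-≤ (64 * (2 * K + s)) (≤-reflexive x+s≡4K)) (+-mono-≤
        (*-monoʳ-≤ (11 * K) 16s≤K) (+-mono-≤ (*-monoʳ-≤ (16 * K) 24≤K) 24≤K)))) (eq₂ K s x)
    impossible : ∀ {z} → z ≡ 2 * K + s → z + 5 * (z * K) + 32 * (K * K) ≤ 2 * (z * z) + 4 * (z * x) + 24 * K → ⊥
    impossible refl = final

-- Each exceptional vertex loses `x - 5K/2`, about `3K/2`, from the maximal degree sum `zx`, while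
-- the total loss is at most `4K + 2s`; three of them lose too much.
at-most-two : ∀ {K x z s c w m F} → x + s ≡ 4 * K → z ≡ c + w → 16 * s ≤ K → 1 ≤ K →
  2 * (m + F) ≤ 2 * (w * x) + c * (5 * K) → s * s + z * x ≤ 4 * K + 2 * s + (m + F) → c ≤ 2
at-most-two {K} {x} {s = s} {c} {w} {m} {F} x+s≡4K refl 16s≤K 1≤K light defect =
  ≮⇒≥ λ 3≤c → <-cert (32 * s * s + 5 * K) (+-mono-≤ (*-monoʳ-≤ 16 bound) (+-mono-≤ (*-monoʳ-≤ (32 * c) (≤-reflexive
      (sym x+s≡4K))) (+-mono-≤ (*-monoʳ-≤ (4 + 2 * c) 16s≤K) (+-mono-≤ (*-monoʳ-≤ (46 * K) 3≤c) 1≤K)))) (eq₂ s c x K)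
  where
    eq₁ : ∀ s c x K m F w →
      2 * (s * s) + 2 * (c * x) + (2 * (w * x) + c * (5 * K) + (2 * (4 * K + 2 * s + (m + F)))) + 0
      ≡ 8 * K + 4 * s + 5 * (c * K) + (2 * (m + F) + (2 * (s * s + (c + w) * x)))
    eq₁ = solve-∀
    eq₂ : ∀ s c x K →
      16 * (8 * K + 4 * s + 5 * (c * K)) + (32 * c * (x + s) + ((4 + 2 * c) * K + (46 * K * c + K))) + (1 +
          (32 * s * s + 5 * K))
      ≡ 16 * (2 * (s * s) + 2 * (c * x)) + (32 * c * (4 * K) + ((4 + 2 * c) * (16 * s) + (46 * K * 3 + 1)))
    eq₂ = solve-∀
    bound : 2 * (s * s) + 2 * (c * x) ≤ 8 * K + 4 * s + 5 * (c * K)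
    bound = ≤-cert 0 (+-mono-≤ light (*-monoʳ-≤ 2 defect)) (eq₁ s c x K m F w)

few-leftover : ∀ {K s x} → 16 * s ≤ K → x ≤ 4 * K → 2 * (s * x) ≤ 4 * (K * K)
few-leftover {K} {s} {x} 16s≤K x≤4K = *-cancelˡ-≤ 16 (≤-cert (56 * K * K) (+-mono-≤ (*-monoʳ-≤ 16 (*-monoʳ-≤ s
    (*-monoʳ-≤ 2 x≤4K))) (*-monoˡ-≤ (8 * K) 16s≤K)) (eq s x K))
  where
    eq : ∀ s x K →
      16 * (2 * (s * x)) + (16 * (s * (2 * (4 * K))) + (K * (8 * K))) + (56 * K * K)
      ≡ 16 * (4 * (K * K)) + (16 * (s * (2 * x)) + (16 * s * (8 * K)))
    eq = solve-∀

-- Edge counts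

module _ {n} (G : Graph n) where

  open DecMembership (_≟_ {n}) using (_∈?_)

  V : List (Fin n)
  V = allFin n

  a : Fin n → Fin n → ℕ
  a i j = 𝟙 (adj G i j)

  a-sym : ∀ i j → a i j ≡ a j i
  a-sym i j = cong 𝟙 (adj-sym G i j)

  E : List (Fin n) → List (Fin n) → ℕ
  E K L = ∑ K (λ i → ∑ L (a i))

  E-sym : ∀ K L → E K L ≡ E L K
  E-sym K L = trans (∑-swap K L a)
    (∑-cong (always (λ i → ∑-cong (always (λ j → a-sym j i) K)) L))

  E-++ˡ : ∀ K K′ L → E (K ++ K′) L ≡ E K L + E K′ L
  E-++ˡ K K′ L = ∑-++ K K′ _

  E-++ʳ : ∀ K L L′ → E K (L ++ L′) ≡ E K L + E K L′
  E-++ʳ K L L′ = trans (∑-cong (always (λ i → ∑-++ L L′ (a i)) K)) (∑-+ K _ _)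

  E-↭ˡ : ∀ {K K′} L → K ↭ K′ → E K L ≡ E K′ L
  E-↭ˡ L p = ∑-↭ _ p

  E-↭ʳ : ∀ K {L L′} → L ↭ L′ → E K L ≡ E K L′
  E-↭ʳ K p = ∑-cong (always (λ i → ∑-↭ (a i) p) K)

  E-++² : ∀ K L → E (K ++ L) (K ++ L) ≡ E K K + 2 * E K L + E L L
  E-++² K L = begin
    E (K ++ L) (K ++ L)              ≡⟨ E-++ˡ K L (K ++ L) ⟩
    E K (K ++ L) + E L (K ++ L)      ≡⟨ cong₂ _+_ (E-++ʳ K K L) (E-++ʳ L K L) ⟩
    E K K + E K L + (E L K + E L L)  ≡⟨ cong (λ t → E K K + E K L + (t + E L L)) (E-sym L K) ⟩
    E K K + E K L + (E K L + E L L)  ≡⟨ lemma (E K K) (E K L) (E L L) ⟩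
    E K K + 2 * E K L + E L L        ∎
    where
    open ≡-Reasoning
    lemma : ∀ x y z → x + y + (y + z) ≡ x + 2 * y + z
    lemma = solve-∀

  E-∷² : ∀ v L → E (v ∷ L) (v ∷ L) ≡ 2 * ∑ L (a v) + E L L
  E-∷² v L = begin
    E (v ∷ L) (v ∷ L)                            ≡⟨ E-++² (v ∷ []) L ⟩
    a v v + 0 + 0 + 2 * (∑ L (a v) + 0) + E L L  ≡⟨ cong (λ t → t + 0 + 0 + 2 * (∑ L (a v) + 0) + E L L) (cong 𝟙
        (irrefl G v)) ⟩
    2 * (∑ L (a v) + 0) + E L L  ≡⟨ cong (λ t → 2 * t + E L L) (+-identityʳ (∑ L (a v))) ⟩
    2 * ∑ L (a v) + E L L        ∎
    where open ≡-Reasoning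

  -- The count in the definition of e depends on i <? j; symmetrising it over the two orders removes that dependence.
  module _ (S : Subset n) where

    s : Fin n → ℕ
    s i = 𝟙 (Vec.lookup S i)

    edge : Fin n → Fin n → ℕ
    edge i j = if ⌊ i <? j ⌋ ∧ Vec.lookup S i ∧ Vec.lookup S j ∧ adj G i j then 1 else 0

    edge-symmetrised : ∀ i j → edge i j + edge j i ≡ s i * (s j * a i j)
    edge-symmetrised i j with <-cmp i j
    ... | tri< i<j _ j≮i
      rewrite ⌊⌋-true (i <? j) i<j | ⌊⌋-false (j <? i) j≮i
      with Vec.lookup S i | Vec.lookup S j | adj G i j
    ... | true  | true  | true  = refl
    ... | true  | true  | false = refl
    ... | true  | false | _     = refl
    ... | false | _     | _     = refl
    edge-symmetrised i j | tri> i≮j _ j<i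
      rewrite ⌊⌋-false (i <? j) i≮j | ⌊⌋-true (j <? i) j<i | adj-sym G j i
      with Vec.lookup S i | Vec.lookup S j | adj G i j
    ... | true  | true  | true  = refl
    ... | true  | true  | false = refl
    ... | true  | false | _     = refl
    ... | false | true  | _     = refl
    ... | false | false | _     = refl
    edge-symmetrised i j | tri≈ i≮i refl _
      rewrite ⌊⌋-false (i <? i) i≮i | irrefl G i
      with Vec.lookup S i
    ... | true  = refl
    ... | false = refl

    2e-weighted : 2 * e G S ≡ ∑ V (λ i → s i * ∑ V (λ j → s j * a i j))
    2e-weighted = begin
      2 * e G S
        ≡⟨ cong (2 *_) (sum-concatMap V V edge) ⟩
      2 * ∑ V (λ i → ∑ V (edge i))
        ≡⟨ cong (∑ V (λ i → ∑ V (edge i)) +_) (+-identityʳ _) ⟩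
      ∑ V (λ i → ∑ V (edge i)) + ∑ V (λ i → ∑ V (edge i))
        ≡⟨ cong (∑ V (λ i → ∑ V (edge i)) +_) (∑-swap V V edge) ⟩
      ∑ V (λ i → ∑ V (edge i)) + ∑ V (λ i → ∑ V (λ j → edge j i))
        ≡⟨ ∑-+ V _ _ ⟨
      ∑ V (λ i → ∑ V (edge i) + ∑ V (λ j → edge j i))
        ≡⟨ ∑-cong (always step V) ⟩
      ∑ V (λ i → s i * ∑ V (λ j → s j * a i j)) ∎
      where
      open ≡-Reasoning
      step : ∀ i → ∑ V (edge i) + ∑ V (λ j → edge j i) ≡ s i * ∑ V (λ j → s j * a i j)
      step i = begin
        ∑ V (edge i) + ∑ V (λ j → edge j i)  ≡⟨ ∑-+ V _ _ ⟨
        ∑ V (λ j → edge i j + edge j i)      ≡⟨ ∑-cong (always (edge-symmetrised i) V) ⟩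
        ∑ V (λ j → s i * (s j * a i j))      ≡⟨ ∑-*ˡ (s i) V _ ⟩
        s i * ∑ V (λ j → s j * a i j)        ∎

    module _ {K L : List (Fin n)} (K++L↭V : K ++ L ↭ V)
             (on-K : All (λ i → Vec.lookup S i ≡ true) K)
             (on-L : All (λ i → Vec.lookup S i ≡ false) L) where

      ∑-indicator : ∀ f → ∑ V (λ i → s i * f i) ≡ ∑ K f
      ∑-indicator f = begin
        ∑ V (λ i → s i * f i)         ≡⟨ ∑-↭ _ K++L↭V ⟨
        ∑ (K ++ L) (λ i → s i * f i)  ≡⟨ ∑-++ K L _ ⟩
        ∑ K (λ i → s i * f i) + ∑ L (λ i → s i * f i)
          ≡⟨ cong₂ _+_ (∑-cong (All.map (λ {i} p → trans (cong (λ t → 𝟙 t * f i) p) (+-identityʳ (f i))) on-K))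
                       (∑-cong (All.map (λ {i} p → cong (λ t → 𝟙 t * f i) p) on-L)) ⟩
        ∑ K f + ∑ L (λ _ → 0)  ≡⟨ cong (∑ K f +_) (trans (∑-const L 0) (*-zeroʳ (length L))) ⟩
        ∑ K f + 0              ≡⟨ +-identityʳ _ ⟩
        ∑ K f                  ∎
        where open ≡-Reasoning

      2e≡E : 2 * e G S ≡ E K K
      2e≡E = trans 2e-weighted (trans (∑-indicator _)
               (∑-cong (always (λ i → ∑-indicator (a i)) K)))

  -- Passes from lists back to subsets: `V` has no repetitions, so neither has `K ++ L`, and
  -- membership in `K` is false on all of `L`.
  realise : ∀ {K L} → K ++ L ↭ V → ∃ λ (S : Subset n) →
    ∣ S ∣ ≡ length K × ∣ ∁ S ∣ ≡ length L ×
    2 * e G S ≡ E K K × 2 * e G (∁ S) ≡ E L L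
  realise {K} {L} K++L↭V = S , card , card-∁ , 2e≡E S K++L↭V S-on-K S-on-L ,
    2e≡E (∁ S) (↭-trans (++-comm L K) K++L↭V)
      (All.map (λ {i} p → trans (lookup-map i not S) (cong not p)) S-on-L)
      (All.map (λ {i} p → trans (lookup-map i not S) (cong not p)) S-on-K)
    where
    open ≡-Reasoning
    member : Fin n → Bool
    member i = does (i ∈? K)
    S : Subset n
    S = Vec.tabulate member
    unique : Unique (K ++ L)
    unique = PermutationSetoid.Unique-resp-↭ (setoid (Fin n)) (↭⇒↭ₛ (↭-sym K++L↭V)) (Unique.allFin⁺ n)
    S-on-K : All (λ i → Vec.lookup S i ≡ true) K
    S-on-K = All.tabulate λ {i} i∈K →
      trans (lookup∘tabulate _ i) (dec-true (i ∈? K) i∈K)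
    S-on-L : All (λ i → Vec.lookup S i ≡ false) L
    S-on-L = All.tabulate λ {i} i∈L →
      trans (lookup∘tabulate _ i)
            (dec-false (i ∈? K) (λ i∈K → Unique⇒disjoint K unique i∈K i∈L))
    card : ∣ S ∣ ≡ length K
    card = begin
      ∣ S ∣                        ≡⟨ card-tabulate member ⟩
      sum (tabulate (𝟙 ∘ member))  ≡⟨ cong sum (map-tabulate id (𝟙 ∘ member)) ⟨
      ∑ V (𝟙 ∘ member)             ≡⟨ ∑-cong (always (λ i → cong 𝟙 (lookup∘tabulate member i)) V) ⟨
      ∑ V (s S)                    ≡⟨ ∑-cong (always (λ i → *-identityʳ (s S i)) V) ⟨
      ∑ V (λ i → s S i * 1)        ≡⟨ ∑-indicator S K++L↭V S-on-K S-on-L (λ _ → 1) ⟩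
      ∑ K (λ _ → 1)                ≡⟨ ∑-const K 1 ⟩
      length K * 1                 ≡⟨ *-identityʳ _ ⟩
      length K                     ∎
    card-∁ : ∣ ∁ S ∣ ≡ length L
    card-∁ = begin
      ∣ ∁ S ∣                           ≡⟨ ∣∁p∣≡n∸∣p∣ S ⟩
      n ∸ ∣ S ∣                         ≡⟨ cong₂ _∸_ (sym (trans (↭-length K++L↭V) (length-tabulate id))) card ⟩
      length (K ++ L) ∸ length K        ≡⟨ cong (_∸ length K) (length-++ K) ⟩
      (length K + length L) ∸ length K  ≡⟨ m+n∸m≡n (length K) (length L) ⟩
      length L                          ∎

  -- Bisections balancing the degrees

  -- The lower bound c on the weights makes the imbalance telescope: each new pair u ≤ v uses up the gap v - u ≤ v - c.
  Halving : (Fin n → ℕ) → ℕ → ℕ → ℕ → List (Fin n) → Set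
  Halving d c D h l = ∃₂ λ A B → A ++ B ↭ l × length A ≡ h × length B ≡ h ×
    2 * (E A A + E B B) ≤ E l l × ∑ A d + c ≤ ∑ B d + D × ∑ B d + c ≤ ∑ A d + D

  -- Greedy induction on consecutive pairs. The pair `u`, `v` is separated, so the edge between them
  -- never lies inside a part. The remaining list is halved with `d v` as its lower bound, so its
  -- imbalance is at most `D - d v`.
  halve : ∀ d {c D} h l → length l ≡ h + h → AllPairs (λ i j → d i ≤ d j) l →
    c ≤ D → All (λ i → c ≤ d i) l → All (λ i → d i ≤ D) l → Halving d c D h l
  halve d zero    []      _  _ c≤D _ _ = [] , [] , ↭-refl , refl , refl , z≤n , c≤D , c≤D
  halve d (suc h) []      ()
  halve d {c} {D} (suc h) (u ∷ []) eq _ _ _ _ with trans eq (cong suc (+-suc h h))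
  ... | ()
  halve d {c} {D} (suc h) (u ∷ v ∷ l) eq ((u≤v ∷ _) ∷ v≤l ∷ sorted) c≤D (c≤u ∷ c≤v ∷ _) (u≤D ∷ v≤D ∷ l≤D)
    with halve d h l (suc-injective (suc-injective (trans eq (cong suc (+-suc h h))))) sorted v≤D v≤l l≤D
  ... | A , B , A++B↭l , lA , lB , sparse , A≤B , B≤A
    -- Of the two ways to place `u` and `v`, the one creating fewer edges inside the parts is taken;
    -- it creates at most half of the edges from the pair to the rest.
    = [ join A B A++B↭l lA lB sparse A≤B B≤A
      , join B A (↭-trans (++-comm B A) A++B↭l) lB lA
          (subst (λ t → 2 * t ≤ E l l) (+-comm (E A A) (E B B)) sparse) B≤A A≤B
      ]′ (≤-total (∑ A (a u) + ∑ B (a v)) (∑ B (a u) + ∑ A (a v)))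
    where
    light : ∀ A B → ∑ A d + d v ≤ ∑ B d + D → (d u + ∑ A d) + c ≤ (d v + ∑ B d) + D
    light A B h = ≤-cert 0 (+-mono-≤ h (+-mono-≤ u≤v c≤v)) (lemma (∑ A d) (∑ B d) (d u) (d v) c D)
      where
      lemma : ∀ A B u v c D → u + A + c + (B + D + (v + v)) + 0 ≡ v + B + D + (A + v + (u + c))
      lemma = solve-∀

    heavy : ∀ A B → ∑ A d + d v ≤ ∑ B d + D → (d v + ∑ A d) + c ≤ (d u + ∑ B d) + D
    heavy A B h = ≤-cert 0 (+-mono-≤ h c≤u) (lemma (∑ A d) (∑ B d) (d u) (d v) c D)
      where
      lemma : ∀ A B u v c D → v + A + c + (B + D + u) + 0 ≡ u + B + D + (A + v + c)
      lemma = solve-∀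

    join : ∀ A B → A ++ B ↭ l → length A ≡ h → length B ≡ h → 2 * (E A A + E B B) ≤ E l l →
           ∑ A d + d v ≤ ∑ B d + D → ∑ B d + d v ≤ ∑ A d + D →
           ∑ A (a u) + ∑ B (a v) ≤ ∑ B (a u) + ∑ A (a v) →
           Halving d c D (suc h) (u ∷ v ∷ l)
    join A B A++B↭l lA lB sparse A≤B B≤A p = u ∷ A , v ∷ B ,
      prep u (↭-trans (shift v A B) (prep v A++B↭l)) , cong suc lA , cong suc lB ,
      sparse′ , light A B A≤B , heavy B A B≤A
      where
      open ≤-Reasoning
      deg-split : ∀ w → ∑ l (a w) ≡ ∑ A (a w) + ∑ B (a w)
      deg-split w = trans (sym (∑-↭ (a w) A++B↭l)) (∑-++ A B (a w))

      lemma : ∀ p q r s A B e x → 2 * ((2 * p + A) + (2 * q + B)) + (2 * (r + s) + e) + 2 * x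
        ≡ 2 * (x + (p + r)) + (2 * (s + q) + e) + (2 * (p + q) + 2 * (A + B))
      lemma = solve-∀

      sparse′ : 2 * (E (u ∷ A) (u ∷ A) + E (v ∷ B) (v ∷ B)) ≤ E (u ∷ v ∷ l) (u ∷ v ∷ l)
      sparse′ = begin
        2 * (E (u ∷ A) (u ∷ A) + E (v ∷ B) (v ∷ B))
          ≡⟨ cong (2 *_) (cong₂ _+_ (E-∷² u A) (E-∷² v B)) ⟩
        2 * ((2 * ∑ A (a u) + E A A) + (2 * ∑ B (a v) + E B B))
          ≤⟨ ≤-cert (2 * a u v) (+-mono-≤ (*-monoʳ-≤ 2 p) sparse)
               (lemma (∑ A (a u)) (∑ B (a v)) (∑ B (a u)) (∑ A (a v)) (E A A) (E B B) (E l l) (a u v)) ⟩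
        2 * (a u v + (∑ A (a u) + ∑ B (a u))) + (2 * (∑ A (a v) + ∑ B (a v)) + E l l)
          ≡⟨ cong₂ (λ s t → 2 * (a u v + s) + (2 * t + E l l)) (deg-split u) (deg-split v) ⟨
        2 * (a u v + ∑ l (a u)) + (2 * ∑ l (a v) + E l l)
          ≡⟨ cong (2 * ∑ (v ∷ l) (a u) +_) (E-∷² v l) ⟨
        2 * ∑ (v ∷ l) (a u) + E (v ∷ l) (v ∷ l)
          ≡⟨ E-∷² u (v ∷ l) ⟨
        E (u ∷ v ∷ l) (u ∷ v ∷ l) ∎

  Bisection : ℕ → ℕ → Set
  Bisection h b = ∃₂ λ A B → A ++ B ↭ V × length A ≡ h × length B ≡ h × E A A ≤ b × E B B ≤ b

  -- The edges across the cut contribute equally to both degree sums, so `E A A` and `E B B` differ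
  -- by at most `D`; their sum is at most half of `E V V`.
  balanced-bisection : ∀ h b D → n ≡ h + h → (∀ v → ∑ V (a v) ≤ D) →
    E V V + 2 * D ≤ 4 * b → Bisection h b
  balanced-bisection h b D n≡2h deg≤D few with sort-by (λ v → ∑ V (a v)) V
  ... | l , l↭V , sorted
    with halve (λ v → ∑ V (a v)) {0} h l
           (trans (↭-length l↭V) (trans (length-tabulate {n = n} (λ i → i)) n≡2h))
           sorted z≤n (always (λ _ → z≤n) l) (always deg≤D l)
  ... | A , B , A++B↭l , lA , lB , sparse , A≤B , B≤A =
    A , B , A++B↭V , lA , lB , few-inside A B A++B↭V A≤B sparse′ ,
    few-inside B A (↭-trans (++-comm B A) A++B↭V) B≤A
      (subst (λ t → 2 * t ≤ E V V) (+-comm (E A A) (E B B)) sparse′)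
    where
    open ≤-Reasoning
    A++B↭V : A ++ B ↭ V
    A++B↭V = ↭-trans A++B↭l l↭V

    sparse′ : 2 * (E A A + E B B) ≤ E V V
    sparse′ = ≤-trans sparse (≤-reflexive (trans (E-↭ˡ l l↭V) (E-↭ʳ V l↭V)))

    E-V : ∀ A B → A ++ B ↭ V → E A V ≡ E A A + E A B
    E-V A B p = trans (sym (E-↭ʳ A p)) (E-++ʳ A A B)

    lemma : ∀ x y w D → 4 * x + (2 * (y + D) + w) + 0 ≡ w + 2 * D + (2 * x + 2 * (x + y))
    lemma = solve-∀

    few-inside : ∀ A B → A ++ B ↭ V → E A V + 0 ≤ E B V + D →
                 2 * (E A A + E B B) ≤ E V V → E A A ≤ b
    few-inside A B A++B↭V A≤B sparse = *-cancelˡ-≤ 4 (≤-trans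
      (≤-cert 0 (+-mono-≤ (*-monoʳ-≤ 2 A≤B+D) sparse) (lemma (E A A) (E B B) (E V V) D)) few)
      where
      shuffle : ∀ y z D → y + z + D ≡ y + D + z
      shuffle = solve-∀
      A≤B+D : E A A ≤ E B B + D
      A≤B+D = +-cancelʳ-≤ (E A B) (E A A) (E B B + D) (begin
        E A A + E A B      ≡⟨ E-V A B A++B↭V ⟨
        E A V              ≡⟨ +-identityʳ _ ⟨
        E A V + 0          ≤⟨ A≤B ⟩
        E B V + D          ≡⟨ cong (_+ D) (E-V B A (↭-trans (++-comm B A) A++B↭V)) ⟩
        E B B + E B A + D  ≡⟨ cong (λ t → E B B + t + D) (E-sym B A) ⟩
        E B B + E A B + D  ≡⟨ shuffle (E B B) (E A B) D ⟩
        E B B + D + E A B  ∎)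

  -- Bisections along the neighbourhood of a vertex of maximum degree

  E-≤ : ∀ K L {c} → All (λ v → ∑ L (a v) ≤ c) K → E K L ≤ length K * c
  E-≤ K L = ∑-bound

  a≤1 : ∀ i j → a i j ≤ 1
  a≤1 i j with adj G i j
  ... | true  = ≤-refl
  ... | false = z≤n

  nbrs≤length : ∀ L i → ∑ L (a i) ≤ length L
  nbrs≤length L i = ≤-trans (∑-bound (always (a≤1 i) L)) (≤-reflexive (*-identityʳ (length L)))

  E-split : ∀ K L M {N} → L ++ M ↭ N → E K N ≡ E K L + E K M
  E-split K L M p = trans (sym (E-↭ʳ K p)) (E-++ʳ K L M)

  E-splitˡ : ∀ K L {M} N → K ++ L ↭ M → E M N ≡ E K N + E L N
  E-splitˡ K L N p = trans (sym (E-↭ˡ N p)) (E-++ˡ K L N)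

  E-split² : ∀ K L {M} → K ++ L ↭ M → E M M ≡ E K K + 2 * E K L + E L L
  E-split² K L {M} p = trans (sym (trans (E-↭ˡ (K ++ L) p) (E-↭ʳ M p))) (E-++² K L)

  E-mono² : ∀ K L {M} → K ++ L ↭ M → E K K ≤ E M M × E L L ≤ E M M
  E-mono² K L p =
    ≤-trans (m≤m+n (E K K) (2 * E K L)) (≤-trans (m≤m+n _ (E L L)) (≤-reflexive (sym (E-split² K L p)))) ,
    ≤-trans (m≤n+m (E L L) (E K K + 2 * E K L)) (≤-reflexive (sym (E-split² K L p)))

  independent-part : ∀ K L {M} → K ++ L ↭ M → E M M ≡ 0 → E K K ≡ 0 × E L L ≡ 0
  independent-part K L p indep with E-mono² K L p
  ... | K≤ , L≤ = n≤0⇒n≡0 (≤-trans K≤ (≤-reflexive indep)) , n≤0⇒n≡0 (≤-trans L≤ (≤-reflexive indep))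

  E-independent-++ : ∀ K L → E K K ≡ 0 → E (K ++ L) (K ++ L) ≡ 2 * E K L + E L L
  E-independent-++ K L indep = trans (E-++² K L) (cong (λ t → t + 2 * E K L + E L L) indep)

  bipartite-bound : ∀ K L → E K K ≡ 0 → E L L ≡ 0 → E (K ++ L) (K ++ L) ≤ 2 * (length K * length L)
  bipartite-bound K L indep-K indep-L = begin
    E (K ++ L) (K ++ L)        ≡⟨ E-independent-++ K L indep-K ⟩
    2 * E K L + E L L          ≡⟨ cong (2 * E K L +_) indep-L ⟩
    2 * E K L + 0              ≡⟨ +-identityʳ _ ⟩
    2 * E K L                  ≤⟨ *-monoʳ-≤ 2 (E-≤ K L (always (nbrs≤length L) K)) ⟩
    2 * (length K * length L)  ∎
    where open ≤-Reasoning

  -- Consequences of triangle-freeness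

  module _ (triangle-free : TriangleFree G) where

    disjoint-neighbourhoods : ∀ L {i j} → adj G i j ≡ true → ∑ L (a i) + ∑ L (a j) ≤ length L
    disjoint-neighbourhoods L {i} {j} i~j =
      ≤-trans (≤-reflexive (sym (∑-+ L (a i) (a j))))
        (≤-trans (∑-bound (always at-most-one L)) (≤-reflexive (*-identityʳ (length L))))
      where
      at-most-one : ∀ l → a i l + a j l ≤ 1
      at-most-one l with adj G i l in i~l | adj G j l in j~l
      ... | true  | true  = contradiction (i~j , j~l , i~l) (triangle-free i j l)
      ... | true  | false = ≤-refl
      ... | false | true  = ≤-refl
      ... | false | false = z≤n

    -- A neighbour of `c` in `L` is adjacent to no neighbour of `c` in `K`, so each pair of such
    -- neighbours is a missing edge.
    missing-edges : ∀ c K L → ∑ L (a c) * ∑ K (a c) + E L K ≤ length L * length K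
    missing-edges c K L = begin
      ∑ L (a c) * ∑ K (a c) + E L K              ≡⟨ cong (_+ E L K) (*-comm (∑ L (a c)) (∑ K (a c))) ⟩
      ∑ K (a c) * ∑ L (a c) + E L K              ≡⟨ cong (_+ E L K) (∑-*ˡ (∑ K (a c)) L (a c)) ⟨
      ∑ L (λ i → ∑ K (a c) * a c i) + E L K      ≡⟨ ∑-+ L _ _ ⟨
      ∑ L (λ i → ∑ K (a c) * a c i + ∑ K (a i))  ≤⟨ ∑-bound (always step L) ⟩
      length L * length K                        ∎
      where
      open ≤-Reasoning
      step : ∀ i → ∑ K (a c) * a c i + ∑ K (a i) ≤ length K
      step i with adj G c i in c~i
      ... | true  = ≤-trans (≤-reflexive (cong (_+ ∑ K (a i)) (*-identityʳ _))) (disjoint-neighbourhoods K c~i)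
      ... | false = ≤-trans (≤-reflexive (cong (_+ ∑ K (a i)) (*-zeroʳ (∑ K (a c))))) (nbrs≤length K i)

    -- Two adjacent vertices have disjoint neighbourhoods, which cannot both exceed half of `X`.
    majority-independent : ∀ X W → All (λ w → length X < 2 * ∑ X (a w)) W → E W W ≡ 0
    majority-independent X W heavy = ∑-zero (All.map (λ {i} hi → ∑-zero (All.map
        (λ {j} hj → no-edge i j hi hj) heavy)) heavy)
      where
      no-edge : ∀ i j → length X < 2 * ∑ X (a i) → length X < 2 * ∑ X (a j) → a i j ≡ 0
      no-edge i j hi hj with adj G i j in i~j
      ... | false = refl
      ... | true  = contradiction (+-mono-≤ (+-mono-≤ hi hj) (*-monoʳ-≤ 2 (disjoint-neighbourhoods X i~j)))
                      (λ l → <-cert 1 l (eq (∑ X (a i)) (∑ X (a j)) (length X)))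
        where
        eq : ∀ p q x → 2 * p + 2 * q + 2 * x + 2 ≡ suc x + suc x + 2 * (p + q)
        eq = solve-∀

    -- Dense graphs with an independent set as large as the maximum degree

    module _ (K : ℕ) (1056≤K : 1056 ≤ K) (n≡6K : n ≡ 6 * K)
             (X Z : List (Fin n)) (X++Z↭V : X ++ Z ↭ V) (X-indep : E X X ≡ 0)
             (deg≤ : ∀ v → ∑ V (a v) ≤ length X)
             (dense : 16 * (K * K) ≤ E V V + 12 * K) where

      open ≤-Reasoning

      private
        x = length X
        z = length Z
        instance
          K≢0 : NonZero K
          K≢0 = >-nonZero (≤-trans (s≤s z≤n) 1056≤K)

      at-least : ∀ {c} → c ≤ 1056 → c ≤ K
      at-least c≤ = ≤-trans c≤ 1056≤K

      x+z≡6K : x + z ≡ 6 * K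
      x+z≡6K = trans (sym (length-↭ X Z X++Z↭V)) (trans (length-tabulate {n = n} (λ i → i)) n≡6K)

      T≡ : E V V ≡ 2 * E X Z + E Z Z
      T≡ = trans (E-split² X Z X++Z↭V) (cong (λ t → t + 2 * E X Z + E Z Z) X-indep)

      degree-sum : ∀ L → E L V ≤ length L * x
      degree-sum L = E-≤ L V (always deg≤ L)

      -- The left side is the degree sum of `Z`. Read as `E Z Z ≤ zx - E X Z`, it charges the edges
      -- inside `Z` to missing pairs between `X` and `Z`.
      spread : E X Z + E Z Z ≤ z * x
      spread = ≤-trans (≤-reflexive (trans (cong (_+ E Z Z) (E-sym X Z)) (sym (E-split Z X Z X++Z↭V)))) (degree-sum Z)

      dense′ : 16 * (K * K) ≤ 2 * E X Z + E Z Z + 12 * K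
      dense′ = subst (λ t → 16 * (K * K) ≤ t + 12 * K) T≡ dense

      inside : ∀ A B {C} → A ++ B ↭ C → ∀ v → ∑ A (a v) ≤ ∑ C (a v)
      inside A B p v = ≤-trans (m≤m+n _ (∑ B (a v))) (≤-reflexive (trans (sym (∑-++ A B (a v))) (∑-↭ (a v) p)))

      Goal : Set
      Goal = Bisection (3 * K) (4 * (K * K))

      -- The case x ≤ n/2

      small-X : x ≤ 3 * K → Goal
      small-X x≤3K with m≤n⇒∃[o]m+o≡n x≤3K
      ... | y , x+y≡3K with split Z y (3 * K) z≡y+3K
        where
        z≡y+3K : z ≡ y + 3 * K
        z≡y+3K = +-cancelˡ-≡ x z (y + 3 * K) (trans x+z≡6K (trans (eq K) (trans (cong (_+ 3 * K) (sym x+y≡3K))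
            (+-assoc x y _))))
          where
          eq : ∀ K → 6 * K ≡ 3 * K + 3 * K
          eq = solve-∀
      ... | Z₁ , Z₂ , Z₁++Z₂≡Z , refl , |Z₂| =
        X ++ Z₁ , Z₂ , perm , trans (length-++ X) x+y≡3K , |Z₂| , few₁ , few₂
        where
        Z₁₂ : Z₁ ++ Z₂ ↭ Z
        Z₁₂ = ↭-reflexive Z₁++Z₂≡Z
        perm : (X ++ Z₁) ++ Z₂ ↭ V
        perm = ↭-trans (++-↭-assoc X Z₁₂) X++Z↭V
        -- As `X` is independent, every edge of this part meets `Z₁`, which has `y` vertices of
        -- degree at most `x`.
        few₁ : E (X ++ Z₁) (X ++ Z₁) ≤ 4 * (K * K)
        few₁ = begin
          E (X ++ Z₁) (X ++ Z₁)     ≡⟨ E-independent-++ X Z₁ X-indep ⟩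
          2 * E X Z₁ + E Z₁ Z₁      ≤⟨ +-monoʳ-≤ (2 * E X Z₁) (m≤m+n (E Z₁ Z₁) (E Z₁ Z₁ + 0)) ⟩
          2 * E X Z₁ + 2 * E Z₁ Z₁  ≡⟨ *-distribˡ-+ 2 (E X Z₁) (E Z₁ Z₁) ⟨
          2 * (E X Z₁ + E Z₁ Z₁)    ≡⟨ cong (λ t → 2 * (t + E Z₁ Z₁)) (E-sym X Z₁) ⟩
          2 * (E Z₁ X + E Z₁ Z₁)    ≡⟨ cong (2 *_) (E-++ʳ Z₁ X Z₁) ⟨
          2 * E Z₁ (X ++ Z₁)        ≤⟨ *-monoʳ-≤ 2 (E-≤ Z₁ (X ++ Z₁) (always (λ v → ≤-trans (inside
              (X ++ Z₁) Z₂ perm v) (deg≤ v)) Z₁)) ⟩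
          2 * (length Z₁ * x)  ≤⟨ small-x₁ x+y≡3K total dense (at-least (m≤m+n 6 _)) ⟩
          4 * (K * K)          ∎
          where
          total : E V V ≤ 6 * K * x
          total = ≤-trans (degree-sum V) (≤-reflexive (cong (_* x) (trans (length-tabulate {n = n} (λ i → i)) n≡6K)))
        few₂ : E Z₂ Z₂ ≤ 4 * (K * K)
        few₂ = ≤-trans (proj₂ (E-mono² Z₁ Z₂ Z₁₂)) (small-x₂ {x = x} {y = length Z₁} {T = E V V} x+y≡3K
          (trans (length-↭ Z₁ Z₂ Z₁₂) (cong (length Z₁ +_) |Z₂|))
          (begin
            E Z Z + E V V                ≡⟨ cong (E Z Z +_) T≡ ⟩
            E Z Z + (2 * E X Z + E Z Z)  ≡⟨ eq (E X Z) (E Z Z) ⟩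
            2 * (E X Z + E Z Z)          ≤⟨ *-monoʳ-≤ 2 spread ⟩
            2 * (z * x)                  ≡⟨ cong (2 *_) (*-comm z x) ⟩
            2 * (x * z)                  ∎)
          dense (at-least (m≤m+n 6 _)))
          where
          eq : ∀ m F → F + (2 * m + F) ≡ 2 * (m + F)
          eq = solve-∀

      other-half : ∀ A B → A ++ B ↭ V → length A ≡ 3 * K → length B ≡ 3 * K
      other-half A B p |A| = +-cancelˡ-≡ (length A) (length B) (3 * K) (begin-equality
        length A + length B  ≡⟨ length-↭ A B p ⟨
        length V             ≡⟨ trans (length-tabulate {n = n} (λ i → i)) n≡6K ⟩
        6 * K                ≡⟨ eq K ⟩
        3 * K + 3 * K        ≡⟨ cong (_+ 3 * K) |A| ⟨
        length A + 3 * K     ∎)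
        where
        eq : ∀ K → 6 * K ≡ 3 * K + 3 * K
        eq = solve-∀

      recombine : ∀ X₁ X₂ Z₁ Z₂ → X₁ ++ X₂ ↭ X → Z₁ ++ Z₂ ↭ Z → (X₁ ++ Z₁) ++ (X₂ ++ Z₂) ↭ V
      recombine X₁ X₂ Z₁ Z₂ p q =
        ↭-trans (interchange X₁ Z₁ X₂ Z₂) (↭-trans (++⁺ p q) X++Z↭V)
        where open CommutativeSemigroup (CommutativeMonoid.commutativeSemigroup ++-commutativeMonoid)
                using (interchange)

      -- Exceptional and majority vertices of Z

      module _ {C W} (C++W↭Z : C ++ W ↭ Z)
               (exceptional : All (λ c → 2 * ∑ X (a c) ≤ x) C)
               (W-indep : E W W ≡ 0) where

        |Z| : z ≡ length C + length W
        |Z| = length-↭ C W C++W↭Z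

        -- The common construction behind `large-X` and `two-exceptional`, which differ only in the
        -- closing inequality `final`. There `p`, `q` and `r` stand for `E X₂ Z₂`, `E X₁ Z₂` and
        -- `E Z₂ Z₂`; `E C V` stays explicit because the two cases bound it differently.
        mixed : ∀ {x′ w′} → x ≡ 2 * K + x′ → length W ≡ K + w′ →
          (∀ {p q r} → 2 * K * p ≤ x′ * q → p + q + r ≤ w′ * x + E C V →
             r ≤ (length C + w′) * (length C + w′) → 2 * p + r ≤ 4 * (K * K)) → Goal
        mixed {x′} {w′} |X| |W| final
          with split W K w′ |W|
        ... | W₁ , W₂ , W₁++W₂≡W , |W₁| , |W₂|
          -- The vertices of `X` with fewest neighbours in `C ++ W₂` join that set; the `2K` others
          -- go with `W₁`.
          with split-light (λ v → ∑ (C ++ W₂) (a v)) X x′ (2 * K) (trans |X| (+-comm (2 * K) x′))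
        ... | X₂ , X₁ , X₂₁ , |X₂| , |X₁| , light =
          X₁ ++ W₁ , X₂ ++ Z₂ , perm , |A| , other-half (X₁ ++ W₁) (X₂ ++ Z₂) perm |A| , few₁ ,
          ≤-trans (≤-reflexive (E-independent-++ X₂ Z₂ (proj₁ X-parts)))
            (final {E X₂ Z₂} {E X₁ Z₂} {E Z₂ Z₂} light total (subst (λ t → E Z₂ Z₂ ≤ t * t) |Z₂| (E-≤ Z₂ Z₂ (always
                (nbrs≤length Z₂) Z₂))))
          where
          Z₂ = C ++ W₂
          X-parts = independent-part X₂ X₁ X₂₁ X-indep
          X₁₂ : X₁ ++ X₂ ↭ X
          X₁₂ = ↭-trans (++-comm X₁ X₂) X₂₁
          W₁₂ : W₁ ++ W₂ ↭ W
          W₁₂ = ↭-reflexive W₁++W₂≡W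
          Z₁₂ : W₁ ++ Z₂ ↭ Z
          Z₁₂ = ↭-trans (shifts W₁ C) (↭-trans (++⁺ˡ C W₁₂) C++W↭Z)
          perm : (X₁ ++ W₁) ++ (X₂ ++ Z₂) ↭ V
          perm = recombine X₁ X₂ W₁ Z₂ X₁₂ Z₁₂
          |A| : length (X₁ ++ W₁) ≡ 3 * K
          |A| = trans (length-++ X₁) (trans (cong₂ _+_ |X₁| |W₁|) (eq K))
            where
            eq : ∀ K → 2 * K + K ≡ 3 * K
            eq = solve-∀
          |Z₂| : length Z₂ ≡ length C + w′
          |Z₂| = trans (length-++ C) (cong (length C +_) |W₂|)
          -- Both `X₁` and `W₁` are independent, and the sizes `2K` and `K` meet the allowed bound
          -- exactly.
          few₁ : E (X₁ ++ W₁) (X₁ ++ W₁) ≤ 4 * (K * K)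
          few₁ = ≤-trans (bipartite-bound X₁ W₁ (proj₂ X-parts) (proj₁ (independent-part W₁ W₂ W₁₂ W-indep)))
            (≤-reflexive (trans (cong₂ (λ s t → 2 * (s * t)) |X₁| |W₁|) (eq K)))
            where
            eq : ∀ K → 2 * (2 * K * K) ≡ 4 * (K * K)
            eq = solve-∀
          total : E X₂ Z₂ + E X₁ Z₂ + E Z₂ Z₂ ≤ w′ * x + E C V
          total = begin
            E X₂ Z₂ + E X₁ Z₂ + E Z₂ Z₂   ≡⟨ cong (_+ E Z₂ Z₂) (trans (sym (E-splitˡ X₂ X₁ Z₂ X₂₁)) (E-sym X Z₂)) ⟩
            E Z₂ X + E Z₂ Z₂              ≤⟨ +-monoʳ-≤ (E Z₂ X) (m≤n+m (E Z₂ Z₂) (E Z₂ W₁)) ⟩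
            E Z₂ X + (E Z₂ W₁ + E Z₂ Z₂)  ≡⟨ cong (E Z₂ X +_) (E-split Z₂ W₁ Z₂ Z₁₂) ⟨
            E Z₂ X + E Z₂ Z               ≡⟨ E-split Z₂ X Z X++Z↭V ⟨
            E Z₂ V                        ≡⟨ E-++ˡ C W₂ V ⟩
            E C V + E W₂ V                ≤⟨ +-monoʳ-≤ (E C V) (degree-sum W₂) ⟩
            E C V + length W₂ * x         ≡⟨ +-comm (E C V) _ ⟩
            length W₂ * x + E C V         ≡⟨ cong (λ t → t * x + E C V) |W₂| ⟩
            w′ * x + E C V                ∎

        -- The case x ≥ 2n/3

        large-X : ∀ {s} → x ≡ 4 * K + s → Goal
        large-X {s} x≡ = with-w (m≤n⇒∃[o]m+o≡n K≤w)
          where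
          z+s≡2K : z + s ≡ 2 * K
          z+s≡2K = +-cancelˡ-≡ (4 * K) (z + s) (2 * K) (trans (eq K z s) (trans (cong (_+ z) (sym x≡)) (trans x+z≡6K
              (eq′ K))))
            where
            eq : ∀ K z s → 4 * K + (z + s) ≡ 4 * K + s + z
            eq = solve-∀
            eq′ : ∀ K → 6 * K ≡ 4 * K + 2 * K
            eq′ = solve-∀
          -- Each vertex of `C` misses at least half of `X`.
          miss : 2 * E X Z + length C * x ≤ 2 * (z * x)
          miss = begin
            2 * E X Z + length C * x
              ≡⟨ cong (λ t → 2 * t + length C * x) (trans (E-sym X Z) (E-splitˡ C W X C++W↭Z)) ⟩
            2 * (E C X + E W X) + length C * x
              ≤⟨ ≤-cert 0 (+-mono-≤ C-bound (*-monoʳ-≤ 2 (E-≤ W X (always (nbrs≤length X) W))))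
                   (eq (E C X) (E W X) (length C) (length W) x) ⟩
            2 * ((length C + length W) * x)
              ≡⟨ cong (λ t → 2 * (t * x)) |Z| ⟨
            2 * (z * x) ∎
            where
            C-bound : 2 * E C X ≤ length C * x
            C-bound = ≤-trans (≤-reflexive (sym (∑-*ˡ 2 C (λ c → ∑ X (a c))))) (∑-bound exceptional)
            eq : ∀ p q c w x → 2 * (p + q) + c * x + (c * x + 2 * (w * x)) + 0 ≡ 2 * ((c + w) * x) + (2 * p + 2 * q)
            eq = solve-∀
          |C|≤6 : length C ≤ 6
          |C|≤6 = few-exceptional {m = E X Z} {F = E Z Z} x≡ z+s≡2K spread dense′ miss
          K+6≤z : K + 6 ≤ z
          K+6≤z = large-Z {T = E V V} (≤-trans (m≤m+n x z) (≤-reflexive x+z≡6K))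
            (begin
              E V V                  ≡⟨ T≡ ⟩
              2 * E X Z + E Z Z      ≤⟨ +-monoʳ-≤ (2 * E X Z) (m≤m+n (E Z Z) (E Z Z + 0)) ⟩
              2 * E X Z + 2 * E Z Z  ≡⟨ *-distribˡ-+ 2 (E X Z) (E Z Z) ⟨
              2 * (E X Z + E Z Z)    ≤⟨ *-monoʳ-≤ 2 spread ⟩
              2 * (z * x)            ∎)
            dense (at-least (m≤m+n 21 _))
          -- This leaves enough vertices in `W` for `mixed` to choose `K` of them.
          K≤w : K ≤ length W
          K≤w = +-cancelʳ-≤ 6 K (length W) (≤-trans K+6≤z (≤-trans (≤-reflexive (trans |Z| (+-comm (length C)
              (length W)))) (+-monoʳ-≤ (length W) |C|≤6)))
          with-w : (∃ λ w′ → K + w′ ≡ length W) → Goal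
          with-w (w′ , K+w′≡w) = mixed (trans x≡ (eq K s)) (sym K+w′≡w) λ {p} {q} {r} light total _ →
            wide-bound {p = p} {q} {r} K≡u+s refl (trans x≡ (eq K s)) light
              (≤-trans total (≤-trans (+-monoʳ-≤ (w′ * x) (degree-sum C)) (≤-reflexive (trans (sym
                  (*-distribʳ-+ x w′ (length C))) (cong (_* x) (+-comm w′ (length C)))))))
            where
            eq : ∀ K s → 4 * K + s ≡ 2 * K + (2 * K + s)
            eq = solve-∀
            K≡u+s : K ≡ length C + w′ + s
            K≡u+s = +-cancelˡ-≡ K K (length C + w′ + s) (trans (eq₁ K) (trans (sym z+s≡2K) (trans (cong (_+ s)
                (trans |Z| (cong (length C +_) (sym K+w′≡w)))) (eq₂ (length C) K w′ s))))
              where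
              eq₁ : ∀ K → K + K ≡ 2 * K
              eq₁ = solve-∀
              eq₂ : ∀ c K w s → c + (K + w) + s ≡ K + (c + w + s)
              eq₂ = solve-∀

        -- The case n/2 ≤ x < 2n/3

        module _ {y s} (x≡ : x ≡ 3 * K + y) (y+s≡K : K ≡ y + s) (1≤s : 1 ≤ s) where

          z≡ : z ≡ 2 * K + s
          z≡ = +-cancelˡ-≡ x z (2 * K + s) (trans x+z≡6K (trans (eq₁ K) (trans (cong
              (λ t → 3 * K + 2 * K + t) y+s≡K) (trans (eq₂ K y s) (cong (_+ (2 * K + s)) (sym x≡))))))
            where
            eq₁ : ∀ K → 6 * K ≡ 3 * K + 2 * K + K
            eq₁ = solve-∀
            eq₂ : ∀ K y s → 3 * K + 2 * K + (y + s) ≡ 3 * K + y + (2 * K + s)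
            eq₂ = solve-∀

          x+s≡4K : x + s ≡ 4 * K
          x+s≡4K = trans (cong (_+ s) x≡) (trans (+-assoc (3 * K) y s) (trans (cong (3 * K +_) (sym y+s≡K)) (eq K)))
            where
            eq : ∀ K → 3 * K + K ≡ 4 * K
            eq = solve-∀

          -- One part is bipartite with sides `K` and `2K`. In the other, only the `s` vertices of
          -- `Z₂` lie outside the independent set `X₂`, so it has at most `sx` edges.
          cover-leftover : ∀ {w′} → 16 * s ≤ K → length W ≡ 2 * K + w′ → Goal
          cover-leftover {w′} 16s≤K |W|
            with split W (2 * K) w′ |W| | split X K (2 * K + y) (trans x≡ (eq K y))
            where
            eq : ∀ K y → 3 * K + y ≡ K + (2 * K + y)
            eq = solve-∀
          ... | W₁ , W₂ , W₁++W₂≡W , |W₁| , |W₂| | X₁ , X₂ , X₁++X₂≡X , |X₁| , |X₂| =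
            X₁ ++ W₁ , X₂ ++ Z₂ , perm , |A| , other-half (X₁ ++ W₁) (X₂ ++ Z₂) perm |A| , few₁ , few₂
            where
            Z₂ = C ++ W₂
            X₁₂ : X₁ ++ X₂ ↭ X
            X₁₂ = ↭-reflexive X₁++X₂≡X
            X-parts = independent-part X₁ X₂ X₁₂ X-indep
            W₁₂ : W₁ ++ W₂ ↭ W
            W₁₂ = ↭-reflexive W₁++W₂≡W
            Z₁₂ : W₁ ++ Z₂ ↭ Z
            Z₁₂ = ↭-trans (shifts W₁ C) (↭-trans (++⁺ˡ C W₁₂) C++W↭Z)
            perm : (X₁ ++ W₁) ++ (X₂ ++ Z₂) ↭ V
            perm = recombine X₁ X₂ W₁ Z₂ X₁₂ Z₁₂
            |A| : length (X₁ ++ W₁) ≡ 3 * K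
            |A| = trans (length-++ X₁) (cong₂ _+_ |X₁| |W₁|)
            |Z₂| : length Z₂ ≡ s
            |Z₂| = +-cancelˡ-≡ (2 * K) (length Z₂) s (trans (cong (_+ length Z₂) (sym |W₁|)) (trans (sym
                (length-↭ W₁ Z₂ Z₁₂)) z≡))
            few₁ : E (X₁ ++ W₁) (X₁ ++ W₁) ≤ 4 * (K * K)
            few₁ = ≤-trans (bipartite-bound X₁ W₁ (proj₁ X-parts) (proj₁ (independent-part W₁ W₂ W₁₂ W-indep)))
              (≤-reflexive (trans (cong₂ (λ s t → 2 * (s * t)) |X₁| |W₁|) (eq K)))
              where
              eq : ∀ K → 2 * (K * (2 * K)) ≡ 4 * (K * K)
              eq = solve-∀
            few₂ : E (X₂ ++ Z₂) (X₂ ++ Z₂) ≤ 4 * (K * K)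
            few₂ = begin
              E (X₂ ++ Z₂) (X₂ ++ Z₂)    ≡⟨ E-independent-++ X₂ Z₂ (proj₂ X-parts) ⟩
              2 * E X₂ Z₂ + E Z₂ Z₂      ≤⟨ +-monoʳ-≤ (2 * E X₂ Z₂) (m≤m+n (E Z₂ Z₂) (E Z₂ Z₂ + 0)) ⟩
              2 * E X₂ Z₂ + 2 * E Z₂ Z₂  ≡⟨ *-distribˡ-+ 2 (E X₂ Z₂) (E Z₂ Z₂) ⟨
              2 * (E X₂ Z₂ + E Z₂ Z₂)    ≡⟨ cong (λ t → 2 * (t + E Z₂ Z₂)) (E-sym X₂ Z₂) ⟩
              2 * (E Z₂ X₂ + E Z₂ Z₂)    ≡⟨ cong (2 *_) (E-++ʳ Z₂ X₂ Z₂) ⟨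
              2 * E Z₂ (X₂ ++ Z₂)        ≤⟨ *-monoʳ-≤ 2 (E-≤ Z₂ (X₂ ++ Z₂) (always (λ v → ≤-trans (inside
                  (X₂ ++ Z₂) (X₁ ++ W₁) (↭-trans (++-comm (X₂ ++ Z₂) (X₁ ++ W₁)) perm) v) (deg≤ v)) Z₂)) ⟩
              2 * (length Z₂ * x)  ≡⟨ cong (λ t → 2 * (t * x)) |Z₂| ⟩
              2 * (s * x)          ≤⟨ few-leftover {s = s} 16s≤K x≤4K ⟩
              4 * (K * K)          ∎
              where
              x≤4K : x ≤ 4 * K
              x≤4K = ≤-trans (m≤m+n x s) (≤-reflexive x+s≡4K)

          -- Here `W` has only `2K - 1` vertices, one too few for `cover-leftover`, so `mixed` is
          -- used with `x′ = 2K - 1` and `w′ = K - 1`.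
          two-exceptional : length C ≡ 2 → s ≡ 1 → 2 * E C V ≤ length C * (5 * K) → Goal
          two-exceptional |C| refl C-light = mixed {K + y} {y} (trans x≡ (eq₁ K y)) |W|
            λ {p} {q} {r} light total small → tight-bound {p = p} {q} {r} K≡1+y
              (trans (cong (_+ y) K≡1+y) (eq₂ y)) (trans x≡ (trans (cong (λ t → 3 * t + y) K≡1+y) (eq₃ y))) 3≤y light
              (≤-trans total (+-monoʳ-≤ (y * x) (*-cancelˡ-≤ 2 (≤-trans C-light (≤-reflexive (cong (_*
                  (5 * K)) |C|))))))
              (subst (λ t → r ≤ t * t) (trans (cong (_+ y) |C|) (+-comm 2 y)) small)
            where
            K≡1+y : K ≡ 1 + y
            K≡1+y = trans y+s≡K (+-comm y 1)
            3≤y : 3 ≤ y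
            3≤y = +-cancelˡ-≤ 1 3 y (≤-trans (at-least (m≤m+n 4 _)) (≤-reflexive K≡1+y))
            eq₁ : ∀ K y → 3 * K + y ≡ 2 * K + (K + y)
            eq₁ = solve-∀
            eq₂ : ∀ y → 1 + y + y ≡ 2 * y + 1
            eq₂ = solve-∀
            eq₃ : ∀ y → 3 * (1 + y) + y ≡ 4 * y + 3
            eq₃ = solve-∀
            |W| : length W ≡ K + y
            |W| = +-cancelˡ-≡ 2 (length W) (K + y) (trans (cong (_+ length W) (sym |C|)) (trans (sym |Z|) (trans z≡
                (trans (cong (λ t → K + (t + 0) + 1) K≡1+y) (eq K y)))))
              where
              eq : ∀ K y → K + (1 + y + 0) + 1 ≡ 2 + (K + y)
              eq = solve-∀

          -- The hypothesis says that the degree sum of `Z` is almost maximal, so `Z` has little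
          -- room for vertices of low degree such as those in `C`.
          near-extremal : s * s + z * x ≤ 4 * K + 2 * s + (E X Z + E Z Z) → Goal
          near-extremal defect = conclude (length C ≤? s)
            where
            -- Combining `defect` with `spread` cancels the edge counts and leaves `s² ≤ 4K + 2s`.
            16s≤K : 16 * s ≤ K
            16s≤K = s-small {K} {s} 1056≤K (≤-cert 0 (+-mono-≤ defect spread) (eq (s * s) (4 * K + 2 * s) (z * x)
                (E X Z + E Z Z)))
              where
              eq : ∀ a b c d → a + (b + d + c) + 0 ≡ b + (a + c + d)
              eq = solve-∀
            degree-C : All (λ c → 2 * ∑ V (a c) ≤ 5 * K) C
            degree-C = All.map (λ {c} 2p≤x →
              subst (λ t → 2 * t ≤ 5 * K) (trans (sym (∑-++ X Z (a c))) (∑-↭ (a c) X++Z↭V))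
                (light-exceptional {p = ∑ X (a c)} {∑ Z (a c)} {E X Z} {E Z Z} x+s≡4K z≡ 16s≤K (at-least
                    (m≤m+n 24 _)) 2p≤x
                  (nbrs≤length Z c) (subst (λ t → ∑ Z (a c) * ∑ X (a c) + t ≤ z * x) (E-sym Z X)
                      (missing-edges c X Z)) spread dense′))
              exceptional
            C-light : 2 * E C V ≤ length C * (5 * K)
            C-light = ≤-trans (≤-reflexive (sym (∑-*ˡ 2 C (λ c → ∑ V (a c))))) (∑-bound degree-C)
            Z-light : 2 * (E X Z + E Z Z) ≤ 2 * (length W * x) + length C * (5 * K)
            Z-light = begin
              2 * (E X Z + E Z Z)                      ≡⟨ cong (λ t → 2 * (t + E Z Z)) (E-sym X Z) ⟩
              2 * (E Z X + E Z Z)                      ≡⟨ cong (2 *_) (E-split Z X Z X++Z↭V) ⟨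
              2 * E Z V                                ≡⟨ cong (2 *_) (E-splitˡ W C V (↭-trans (++-comm W C) C++W↭Z)) ⟩
              2 * (E W V + E C V)                      ≡⟨ *-distribˡ-+ 2 (E W V) (E C V) ⟩
              2 * E W V + 2 * E C V                    ≤⟨ +-mono-≤ (*-monoʳ-≤ 2 (degree-sum W)) C-light ⟩
              2 * (length W * x) + length C * (5 * K)  ∎
            |C|≤2 : length C ≤ 2
            |C|≤2 = at-most-two {m = E X Z} {E Z Z} x+s≡4K |Z| 16s≤K (at-least (m≤m+n 1 _)) Z-light defect
            conclude : _ → Goal
            -- From `1 ≤ s < |C| ≤ 2` only `s = 1` and `|C| = 2` remain.
            conclude (no  s<c) = two-exceptional (≤-antisym |C|≤2 (≤-trans (s≤s 1≤s) (≰⇒> s<c)))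
              (≤-antisym (s≤s⁻¹ (≤-trans (≰⇒> s<c) |C|≤2)) 1≤s) C-light
            conclude (yes c≤s) with m≤n⇒∃[o]m+o≡n c≤s
            ... | w′ , c+w′≡s = cover-leftover {w′} 16s≤K
              (+-cancelˡ-≡ (length C) (length W) (2 * K + w′) (trans (sym |Z|) (trans z≡ (trans (cong (2 * K +_)
                  (sym c+w′≡s)) (eq K (length C) w′)))))
              where
              eq : ∀ K c w → 2 * K + (c + w) ≡ c + (2 * K + w)
              eq = solve-∀

          -- The `3K` vertices of `X` with most neighbours in `Z` form an edgeless part. Either the
          -- complement is sparse enough, or its excess of edges feeds `deficit`.
          medium-X : Goal
          medium-X with split-light (λ v → ∑ Z (a v)) X y (3 * K) (trans x≡ (+-comm (3 * K) y))
          ... | X₂ , X₁ , X₂₁ , |X₂| , |X₁| , light with 2 * E X₂ Z + E Z Z ≤? 4 * (K * K)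
          ... | yes few = X₁ , X₂ ++ Z , perm , |X₁| , other-half X₁ (X₂ ++ Z) perm |X₁| ,
            ≤-trans (≤-reflexive (proj₂ X-parts)) z≤n ,
            ≤-trans (≤-reflexive (E-independent-++ X₂ Z (proj₁ X-parts))) few
            where
            X-parts = independent-part X₂ X₁ X₂₁ X-indep
            perm : X₁ ++ (X₂ ++ Z) ↭ V
            perm = ↭-trans (shifts X₁ X₂) (↭-trans (↭-reflexive (sym (++-assoc X₂ X₁ Z))) (↭-trans
                (++⁺ʳ Z X₂₁) X++Z↭V))
          ... | no many = near-extremal (subst (λ t → s * s + z * x ≤ 4 * K + 2 * s + (t + E Z Z)) m≡
            (deficit {p = E X₁ Z} {E X₂ Z} {E Z Z} y+s≡K x≡ z≡ light (<⇒≤ (≰⇒> many))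
              (subst (λ t → 16 * (K * K) ≤ 2 * t + E Z Z + 12 * K) (sym m≡) dense′)))
            where
            m≡ : E X₁ Z + E X₂ Z ≡ E X Z
            m≡ = sym (E-splitˡ X₁ X₂ Z (↭-trans (++-comm X₁ X₂) X₂₁))

  -- Choice of the vertex and distinction of cases

  max-degree-vertex : Fin n → ∃ λ v → ∀ i → ∑ V (a i) ≤ ∑ V (a v)
  max-degree-vertex v₀ = argmax deg v₀ V , λ i → All.lookup (f[xs]≤f[argmax] {f = deg} v₀ V) (∈-allFin i)
    where
    deg : Fin n → ℕ
    deg i = ∑ V (a i)

  neighbourhood : TriangleFree G → ∀ v → ∃₂ λ X Z → X ++ Z ↭ V × E X X ≡ 0 × length X ≡ ∑ V (a v)
  neighbourhood triangle-free v with ↭-filter (λ i → adj G v i Bool.≟ true) V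
  ... | X , Z , X++Z↭V , X-adj , Z-nonadj = X , Z , X++Z↭V ,
    ∑-zero (All.map (λ {i} v~i → ∑-zero (All.map (λ {j} v~j → no-edge i j v~i v~j) X-adj)) X-adj) , (begin
      length X       ≡⟨ *-identityʳ (length X) ⟨
      length X * 1   ≡⟨ ∑-const X 1 ⟨
      ∑ X (λ _ → 1)  ≡⟨ ∑-cong (All.map (λ v~i → cong 𝟙 v~i) X-adj) ⟨
      ∑ X (a v)      ≡⟨ +-identityʳ _ ⟨
      ∑ X (a v) + 0  ≡⟨ cong (∑ X (a v) +_) (∑-zero (All.map (λ v≁i → cong 𝟙
          (Bool.¬-not v≁i)) Z-nonadj)) ⟨
      ∑ X (a v) + ∑ Z (a v)  ≡⟨ ∑-++ X Z (a v) ⟨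
      ∑ (X ++ Z) (a v)       ≡⟨ ∑-↭ (a v) X++Z↭V ⟩
      ∑ V (a v)              ∎)
    where
    open ≡-Reasoning
    no-edge : ∀ i j → adj G v i ≡ true → adj G v j ≡ true → a i j ≡ 0
    no-edge i j v~i v~j with adj G i j in i~j
    ... | true  = contradiction (v~i , i~j , v~j) (triangle-free v i j)
    ... | false = refl

  bisection : TriangleFree G → ∀ K → 1056 ≤ K → n ≡ 6 * K → Fin n → Bisection (3 * K) (4 * (K * K))
  bisection triangle-free K 1056≤K n≡6K v₀
    -- This threshold is `e(G) ≤ 8K² - 6K`, that is `2n²/9 - n`; the term `2 * (6 * K)` comes from
    -- bounding the maximum degree by `n`.
    with E V V + 2 * (6 * K) ≤? 4 * (4 * (K * K))
  ... | yes few = balanced-bisection (3 * K) (4 * (K * K)) (6 * K) (trans n≡6K (eq K))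
    (λ v → ≤-trans (nbrs≤length V v) (≤-reflexive (trans (length-tabulate {n = n} (λ i → i)) n≡6K))) few
    where
    eq : ∀ K → 6 * K ≡ 3 * K + 3 * K
    eq = solve-∀
  ... | no many with max-degree-vertex v₀
  ... | v , max with neighbourhood triangle-free v
  ... | X , Z , X++Z↭V , X-indep , |X| with ↭-filter (λ c → 2 * ∑ X (a c) ≤? length X) Z
  ... | C , W , C++W↭Z , exceptional , typical = by-size (≤-total (length X) (3 * K)) (≤-total (4 * K) (length X))
    where
    dense : 16 * (K * K) ≤ E V V + 12 * K
    dense = ≤-trans (≤-reflexive (eq₁ K)) (≤-trans (<⇒≤ (≰⇒> many)) (≤-reflexive (cong (E V V +_) (eq₂ K))))
      where
      eq₁ : ∀ K → 16 * (K * K) ≡ 4 * (4 * (K * K))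
      eq₁ = solve-∀
      eq₂ : ∀ K → 2 * (6 * K) ≡ 12 * K
      eq₂ = solve-∀
    deg≤ : ∀ i → ∑ V (a i) ≤ length X
    deg≤ i = ≤-trans (max i) (≤-reflexive (sym |X|))
    W-indep = majority-independent triangle-free X W (All.map ≰⇒> typical)
    by-size : length X ≤ 3 * K ⊎ 3 * K ≤ length X → 4 * K ≤ length X ⊎ length X ≤ 4 * K → Bisection (3 * K) (4 *
        (K * K))
    by-size (inj₁ x≤3K) _ = small-X triangle-free K 1056≤K n≡6K X Z X++Z↭V X-indep deg≤ dense x≤3K
    by-size _ (inj₁ 4K≤x) with m≤n⇒∃[o]m+o≡n 4K≤x
    ... | s , 4K+s≡x = large-X triangle-free K 1056≤K n≡6K X Z X++Z↭V X-indep deg≤ dense C++W↭Z exceptional W-indep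
        (sym 4K+s≡x)
    by-size (inj₂ 3K≤x) (inj₂ x≤4K) with m≤n⇒∃[o]m+o≡n 3K≤x | m≤n⇒∃[o]m+o≡n x≤4K
    -- Equality `x = 4K` belongs to the large case, since `medium-X` requires `s ≥ 1`.
    ... | y , 3K+y≡x | zero , x+0≡4K =
      large-X triangle-free K 1056≤K n≡6K X Z X++Z↭V X-indep deg≤ dense C++W↭Z exceptional W-indep {0}
        (trans (trans (sym (+-identityʳ _)) x+0≡4K) (sym (+-identityʳ _)))
    ... | y , 3K+y≡x | suc s , x+s≡4K =
      medium-X triangle-free K 1056≤K n≡6K X Z X++Z↭V X-indep deg≤ dense C++W↭Z exceptional W-indep (sym 3K+y≡x)
        (+-cancelˡ-≡ (3 * K) K (y + suc s) (trans (eq K) (trans (sym x+s≡4K) (trans (cong (_+ suc s) (sym 3K+y≡x))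
            (+-assoc (3 * K) y (suc s))))))
        (s≤s z≤n)
      where
      eq : ∀ K → 3 * K + K ≡ 4 * K
      eq = solve-∀

theorem1p8 : ∃ λ (n₀ : ℕ) → ∀ (n : ℕ) → n₀ ≤ n → 12 divides n →
    ∀ (G : Graph n) → TriangleFree G →
    ∃ λ (A : Subset n) → 2 * ∣ A ∣ ≡ n × 2 * ∣ ∁ A ∣ ≡ n
    × 18 * e G A ≤ n * n × 18 * e G (∁ A) ≤ n * n
-- With `n = 12q` the parameter is `K = n/6 = 2q`, and `6336 = 6 · 1056` gives `K ≥ 1056`.
theorem1p8 = 6336 , λ { n 6336≤n (Divisibility.divides q refl) G triangle-free →
    conclude q G (bisection G triangle-free (q * 2) (large q 6336≤n) (12q q) (first q 6336≤n)) }
  where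
  12q : ∀ q → q * 12 ≡ 6 * (q * 2)
  12q = solve-∀
  large : ∀ q → 6336 ≤ q * 12 → 1056 ≤ q * 2
  large q 6336≤n = *-cancelˡ-≤ 6 (≤-trans 6336≤n (≤-reflexive (12q q)))
  first : ∀ q → 6336 ≤ q * 12 → Fin (q * 12)
  first (suc q) _ = zero
  conclude : ∀ q (G : Graph (q * 12)) → Bisection G (3 * (q * 2)) (4 * (q * 2 * (q * 2))) →
    ∃ λ (A : Subset (q * 12)) → 2 * ∣ A ∣ ≡ q * 12 × 2 * ∣ ∁ A ∣ ≡ q * 12
    × 18 * e G A ≤ q * 12 * (q * 12) × 18 * e G (∁ A) ≤ q * 12 * (q * 12)
  conclude q G (A , B , A++B↭V , |A| , |B| , few-A , few-B) with realise G {A} {B} A++B↭V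
  ... | S , |S| , |∁S| , edges-S , edges-∁S =
    S , trans (cong (2 *_) (trans |S| |A|)) (half q) , trans (cong (2 *_) (trans |∁S| |B|)) (half q) ,
    bound (e G S) edges-S few-A , bound (e G (∁ S)) edges-∁S few-B
    where
    half : ∀ q → 2 * (3 * (q * 2)) ≡ q * 12
    half = solve-∀
    -- A part with `2m ≤ 4K²` has `18m ≤ 36K² = n²`.
    bound : ∀ m {t} → 2 * m ≡ t → t ≤ 4 * (q * 2 * (q * 2)) → 18 * m ≤ q * 12 * (q * 12)
    bound m refl few = ≤-trans (≤-reflexive (eq₁ m)) (≤-trans (*-monoʳ-≤ 9 few) (≤-reflexive (eq₂ q)))
      where
      eq₁ : ∀ m → 18 * m ≡ 9 * (2 * m)
      eq₁ = solve-∀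
      eq₂ : ∀ q → 9 * (4 * (q * 2 * (q * 2))) ≡ q * 12 * (q * 12)
      eq₂ = solve-∀
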